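{- Let $(P,\omega)$ be a canonically labeled sign-graded poset of rank $r$ with $|P|=p$, and write $W(P,\omega;t)=\sum_{i=0}^{\lfloor d/2\rfloor}a_i(P,\omega)t^i(1+t)^{d-2i}$ with $d=p-r-1$. If $r=0$ then $$W(P,\omega;t)=2^{ -p+1}(1+t)^{p-1}\,\overline{W}\big(P,\omega;4t(1+t)^{ -2}\big),$$ equivalently $a_i(P,\omega)=2^{ -p+1+2i}\,|\{\pi\in\mathcal{L}(P,\omega):\operatorname{peak}(\pi)=i\}|$. If $r=1$ then $$W(P,\omega;t)=2^{ -p}t^{ -1}(1+t)^{p}\,\overline{W}\big(\hat{P},\hat{\omega};4t(1+t)^{ -2}\big),$$ equivalently $a_i(P,\omega)=2^{ -p+2+2i}\,|\{\pi\in\mathcal{L}(\hat{P},\hat{\omega}):\operatorname{peak}(\pi)=i+1\}|$.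
   Context: A labeled poset is a pair $(P,\omega)$ with $P$ a finite poset and $\omega:P\to\mathbb{Z}$ injective. Its Jordan–Hölder set $\mathcal{L}(P,\omega)$ is the set of words $\pi=a_1\cdots a_p$ that are permutations of $\omega(P)$ such that $x<_Py$ implies $\omega(x)$ precedes $\omega(y)$ in $\pi$. For $\pi=a_1\cdots a_p$, $\operatorname{des}(\pi)=|\{i\in[p-1]:a_i>a_{i+1}\}|$ and $\operatorname{peak}(\pi)=|\{i\in\{2,\dots,p-1\}:a_{i-1}<a_i>a_{i+1}\}|$. Set $W(P,\omega;t)=\sum_{\pi\in\mathcal{L}(P,\omega)}t^{\operatorname{des}(\pi)}$ and $\overline{W}(P,\omega;t)=\sum_{\pi\in\mathcal{L}(P,\omega)}t^{\operatorname{peak}(\pi)}$. For a cover relation $x\lessdot y$ set $\epsilon(x,y)=1$ if $\omega(x)<\omega(y)$ and $-1$ otherwise. $(P,\omega)$ is sign-graded of rank $r$ if the sum of $\epsilon$ along every maximal chain equals $r$; its rank function $\rho(x)$ is the sum of $\epsilon$ along any saturated chain from a minimal element to $x$. The labeling is canonical if $(P,\omega)$ is sign-graded, $\rho$ takes values in $\{0,1\}$, rank-$0$ elements have negative labels and rank-$1$ elements have positive labels. For a sign-graded poset of rank $r$ the polynomial $W(P,\omega;t)$ admits a (unique) expansion $\sum_{i=0}^{\lfloor d/2\rfloor}a_i(P,\omega)t^i(1+t)^{d-2i}$, $d=p-r-1$. $(\hat{P},\hat{\omega})$ denotes any canonically labeled sign-graded poset where $\hat{P}$ is obtained from $P$ by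 adjoining a greatest element. -}

module Defs where

open import Level using (0ℓ)
open import Data.Nat as ℕ using (ℕ; zero; suc; ⌊_/2⌋)
open import Data.Integer as ℤ using (ℤ; +_; -[1+_]; _+_; _*_; _^_; _<_; _<?_)
open import Data.Fin as Fin using (Fin)
open import Data.Fin.Properties using (all?) renaming (_≟_ to _≟F_)
open import Data.Vec as Vec using (Vec; []; _∷_; lookup; toList)
open import Data.List as List using (List; []; _∷_; concatMap; filter; length; upTo; foldr)
open import Data.Product using (Σ; _×_; _,_)
open import Data.Sum using (_⊎_)
open import Relation.Nullary using (¬_; Dec; yes; no)
open import Relation.Nullary.Decidable using (_×-dec_; _→-dec_; ¬?)
open import Relation.Binary using (Rel; Decidable; IsPartialOrder)
open import Relation.Binary.PropositionalEquality using (_≡_; _≢_)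
open import Function.Definitions using (Injective)

record FinPoset (p : ℕ) : Set₁ where
  field
    _≤P_           : Rel (Fin p) 0ℓ
    isPartialOrder : IsPartialOrder _≡_ _≤P_
    _≤P?_          : Decidable _≤P_

  _<P_ : Rel (Fin p) 0ℓ
  x <P y = (x ≤P y) × (x ≢ y)

  _<P?_ : Decidable _<P_
  x <P? y = (x ≤P? y) ×-dec ¬? (x ≟F y)

  _⋖_ : Rel (Fin p) 0ℓ
  x ⋖ y = (x <P y) × (∀ z → ¬ ((x <P z) × (z <P y)))

  Minimal : Fin p → Set
  Minimal x = ∀ y → ¬ (y <P x)

  Maximal : Fin p → Set
  Maximal x = ∀ y → ¬ (x <P y)

  data Chain : Fin p → Fin p → Set where
    [_]  : ∀ x → Chain x x
    _∷_  : ∀ {x y z} → x ⋖ y → Chain y z → Chain x z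

open FinPoset public

Labeling : ℕ → Set
Labeling p = Σ (Fin p → ℤ) (Injective _≡_ _≡_)

module _ {p : ℕ} (P : FinPoset p) (ω : Fin p → ℤ) where

  ε : Fin p → Fin p → ℤ
  ε x y with ω x <? ω y
  ... | yes _ = + 1
  ... | no  _ = -[1+ 0 ]

  εsum : ∀ {x y} → Chain P x y → ℤ
  εsum [ x ] = + 0
  εsum (_∷_ {x} {y} _ c) = ε x y + εsum c

  SignGraded : ℤ → Set
  SignGraded r = ∀ x y (c : Chain P x y) → Minimal P x → Maximal P y → εsum c ≡ r

  -- canonical labeling: sign-graded, and the rank ρ(y) (= ε-sum of any
  -- saturated chain from a minimal element to y) is 0 with ω y < 0,
  -- or 1 with ω y > 0
  Canonical : Set
  Canonical =
    Σ ℤ SignGraded ×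
    (∀ x y (c : Chain P x y) → Minimal P x →
       ((εsum c ≡ + 0) × (ω y < + 0)) ⊎ ((εsum c ≡ + 1) × (+ 0 < ω y)))

b2ℕ : ∀ {A : Set} → Dec A → ℕ
b2ℕ (yes _) = 1
b2ℕ (no  _) = 0

des : List ℤ → ℕ
des (a ∷ b ∷ w) = b2ℕ (b <? a) ℕ.+ des (b ∷ w)
des _           = 0

peak : List ℤ → ℕ
peak (a ∷ b ∷ c ∷ w) = b2ℕ ((a <? b) ×-dec (c <? b)) ℕ.+ peak (b ∷ c ∷ w)
peak _               = 0

allWords : (n k : ℕ) → List (Vec (Fin n) k)
allWords n zero    = [] ∷ []
allWords n (suc k) = concatMap (λ x → List.map (x ∷_) (allWords n k)) (List.allFin n)

module _ {p : ℕ} (P : FinPoset p) where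

  IsLinExt : Vec (Fin p) p → Set
  IsLinExt π =
    (∀ i j → lookup π i ≡ lookup π j → i ≡ j) ×
    (∀ i j → _<P_ P (lookup π i) (lookup π j) → i Fin.< j)

  isLinExt? : (π : Vec (Fin p) p) → Dec (IsLinExt π)
  isLinExt? π =
    all? (λ i → all? (λ j → (lookup π i ≟F lookup π j) →-dec (i ≟F j)))
    ×-dec
    all? (λ i → all? (λ j → _<P?_ P (lookup π i) (lookup π j) →-dec (i Fin.<? j)))

  linExts : List (Vec (Fin p) p)
  linExts = filter isLinExt? (allWords p p)

module _ {p : ℕ} (P : FinPoset p) (ω : Fin p → ℤ) where

  JH : List (List ℤ)
  JH = List.map (λ π → toList (Vec.map ω π)) (linExts P)

  sumℤ : List ℤ → ℤ
  sumℤ = foldr _+_ (+ 0)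

  W : ℤ → ℤ
  W t = sumℤ (List.map (λ w → t ^ des w) JH)

  peakCount : ℕ → ℕ
  peakCount i = length (filter (λ w → peak w ℕ.≟ i) JH)

gammaExpansion : ℕ → (ℕ → ℤ) → ℤ → ℤ
gammaExpansion d a t =
  foldr _+_ (+ 0)
    (List.map (λ i → a i * (t ^ i) * ((+ 1 + t) ^ (d ℕ.∸ (2 ℕ.* i))))
              (upTo (suc ⌊ d /2⌋)))

IsHat : ∀ {p} → FinPoset p → FinPoset (suc p) → Set
IsHat {p} P P̂ =
  (∀ x y → (_≤P_ P̂ (Fin.inject₁ x) (Fin.inject₁ y) → _≤P_ P x y)
         × (_≤P_ P x y → _≤P_ P̂ (Fin.inject₁ x) (Fin.inject₁ y)))
  × (∀ z → _≤P_ P̂ z (Fin.fromℕ p))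

{-# OPTIONS --safe #-}
module Submission where

-- In a canonically labelled poset the sign of the label changes along every cover, so two
-- comparable elements of the same sign have an element of the other sign between them.  Hence
-- within a maximal run of letters of one sign a linear extension may be permuted freely.
--
-- Weigh a word by a product over its letters of κ l r, where l and r tell whether the left and
-- right neighbour is larger.  With κ l r = 2t or 2 according to l, this gives 2t 2^(p-1) t^des;
-- with κ = 2t at valleys, 2 at peaks and 1 + t elsewhere it gives 2t (4t)^peak (1+t)^(p-1-2peak).
-- Such a weight is multiplicative over the runs, and cutting a negative (positive) run at its
-- largest (smallest) letter expresses its weight by those of the two pieces and one factor κ.  By
-- induction the sum of the weights over all orderings of a run depends only on its size and on
-- the symmetrised values κ l r + κ r l, which coincide for the two choices of κ.  It does not
-- depend on the labels either, which makes ω̂ comparable with ω when r = 1.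

open import Defs
open import Algebra.Properties.AbelianGroup using (∙-cancelˡ)
open import Data.Bool as Bool using (Bool; true; false; not; _∧_; if_then_else_)
open import Data.Bool.ListAction using (all)
import Data.Bool.Properties as Bool
open import Data.Fin as Fin using (Fin; zero; suc; inject₁; fromℕ)
open import Data.Fin.Induction using (po-wellFounded; po-noetherian)
import Data.Fin.Properties as Fin
open import Data.Fin.Relation.Unary.Top using (view; ‵fromℕ; ‵inject₁)
open import Data.Integer as ℤ using (ℤ; +_; _+_; _*_; _^_; _-_; ∣_∣; _<?_)
import Data.Integer.Properties as ℤ
open import Data.Integer.Tactic.RingSolver using (solve-∀)
open import Data.List using (List; []; _∷_; _++_; _∷ʳ_; map; foldr; concatMap; length; upTo; allFin; filter; tabulate)
import Data.List.Membership.DecPropositional as DecMembership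
open import Data.List.Membership.Propositional using (_∈_)
open import Data.List.Membership.Propositional.Properties using (∈-++⁺ˡ; ∈-++⁺ʳ; ∈-++⁻; ∈-map⁺; ∈-map⁻)
open import Data.List.Properties using (++-assoc; map-upTo; map-tabulate)
open import Data.List.Relation.Unary.All as All using (All; []; _∷_)
import Data.List.Relation.Unary.All.Properties as All
open import Data.List.Relation.Unary.AllPairs as AllPairs using (AllPairs; []; _∷_; allPairs?)
import Data.List.Relation.Unary.AllPairs.Properties as AllPairs
open import Data.List.Relation.Unary.Any using (here; there)
open import Data.Nat as ℕ using (ℕ; zero; suc; _∸_; _≤_; _<_; z≤n; s≤s; ⌊_/2⌋)
import Data.Nat.Properties as ℕ
open import Data.Product using (_×_; _,_; ∃; proj₁; proj₂)
open import Data.Sum using (_⊎_; inj₁; inj₂)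
open import Data.Vec as Vec using (Vec; lookup; toList)
import Data.Vec.Properties as Vec
open import Function using (flip; _∘_)
open import Function.Bundles using (mk⇔)
open import Function.Definitions using (Injective)
open import Induction.WellFounded using (Acc; acc)
open import Relation.Binary using (module IsPartialOrder)
open import Relation.Binary.Definitions using (tri<; tri≈; tri>)
open import Relation.Binary.PropositionalEquality using (_≡_; _≢_; refl; sym; trans; cong; cong₂; subst; module ≡-Reasoning)
open import Relation.Nullary using (¬_; Dec; yes; no; does; contradiction)
open import Relation.Nullary.Decidable using (dec-true; dec-false; _×-dec_; ¬?; does-⇔)
open ≡-Reasoning

-- Finite sums and words

-- Since the letters of a run permute freely, its dominating letter is found equally often at every
-- position, so the coefficient of a cut into lengths i and j always comes paired with that of the
-- cut into j and i. Hence only `κ l r + κ r l` matters, although the two weights may differ on a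
-- single word.
--
-- The obstacle is that the pieces left by a cut have varying letter sets, tied to the rest of the
-- word. The induction therefore runs over all functions χ invariant under the allowed swaps, a
-- class closed under fixing a prefix or a suffix, and not over sets of letters.
--
-- The end flags are set as if a positive letter stood before the word and a letter of the opposite
-- sign after it. In rank 0 all words begin and end with negative letters, so valleys outnumber
-- peaks by one: this is the extra 2t. In rank 1 the words end with a positive letter; the new
-- greatest element is negative and adds a valley, which cancels one factor 2t. The factor t that
-- remains beside `W` becomes the shift from i to i + 1.

opaque

  -- Opaque, so that sums keep their shape in equations and summands can be left as `_`; `∑-def`
  -- leads back to the `foldr` of `W` and `gammaExpansion`.
  ∑ : {B : Set} → List B → (B → ℤ) → ℤ
  ∑ xs g = foldr _+_ (+ 0) (map g xs)

  ∑-def : {B : Set} (xs : List B) (g : B → ℤ) → ∑ xs g ≡ foldr _+_ (+ 0) (map g xs)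
  ∑-def xs g = refl

module _ {B : Set} where
  opaque
    unfolding ∑

    ∑-[] : ∀ (g : B → ℤ) → ∑ [] g ≡ + 0
    ∑-[] g = refl

    ∑-∷ : ∀ x xs (g : B → ℤ) → ∑ (x ∷ xs) g ≡ g x + ∑ xs g
    ∑-∷ x xs g = refl

    ∑-[x] : ∀ x (g : B → ℤ) → ∑ (x ∷ []) g ≡ g x
    ∑-[x] x g = ℤ.+-identityʳ (g x)

    ∑-cong : ∀ (xs : List B) {g h : B → ℤ} → (∀ x → g x ≡ h x) → ∑ xs g ≡ ∑ xs h
    ∑-cong []       e = refl
    ∑-cong (x ∷ xs) e = cong₂ _+_ (e x) (∑-cong xs e)

    ∑-0 : ∀ (xs : List B) → ∑ xs (λ _ → + 0) ≡ + 0
    ∑-0 []       = refl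
    ∑-0 (x ∷ xs) = trans (ℤ.+-identityˡ _) (∑-0 xs)

    ∑-+ : ∀ (xs : List B) (g h : B → ℤ) → ∑ xs (λ x → g x + h x) ≡ ∑ xs g + ∑ xs h
    ∑-+ []       g h = refl
    ∑-+ (x ∷ xs) g h = trans (cong (_+_ (g x + h x)) (∑-+ xs g h)) (interchange (g x) (h x) (∑ xs g) (∑ xs h))
      where
      interchange : ∀ a b c d → a + b + (c + d) ≡ a + c + (b + d)
      interchange = solve-∀

    ∑-*ˡ : ∀ (xs : List B) c (g : B → ℤ) → c * ∑ xs g ≡ ∑ xs (λ x → c * g x)
    ∑-*ˡ []       c g = ℤ.*-zeroʳ c
    ∑-*ˡ (x ∷ xs) c g = trans (ℤ.*-distribˡ-+ c (g x) (∑ xs g)) (cong (_+_ (c * g x)) (∑-*ˡ xs c g))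

    ∑-*ʳ : ∀ (xs : List B) c (g : B → ℤ) → ∑ xs g * c ≡ ∑ xs (λ x → g x * c)
    ∑-*ʳ xs c g = trans (ℤ.*-comm _ c) (trans (∑-*ˡ xs c g) (∑-cong xs λ x → ℤ.*-comm c (g x)))

    ∑-++ : ∀ (xs ys : List B) (g : B → ℤ) → ∑ (xs ++ ys) g ≡ ∑ xs g + ∑ ys g
    ∑-++ []       ys g = sym (ℤ.+-identityˡ _)
    ∑-++ (x ∷ xs) ys g = trans (cong (_+_ (g x)) (∑-++ xs ys g)) (sym (ℤ.+-assoc (g x) _ _))

module _ {B C : Set} where
  opaque
    unfolding ∑

    ∑-swap : ∀ (xs : List B) (ys : List C) (g : B → C → ℤ) →
             ∑ xs (λ x → ∑ ys (g x)) ≡ ∑ ys (λ y → ∑ xs (λ x → g x y))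
    ∑-swap []       ys g = sym (∑-0 ys)
    ∑-swap (x ∷ xs) ys g = trans (cong (_+_ (∑ ys (g x))) (∑-swap xs ys g)) (sym (∑-+ ys _ _))

    ∑-map : ∀ (f : B → C) xs (g : C → ℤ) → ∑ (map f xs) g ≡ ∑ xs (λ x → g (f x))
    ∑-map f []       g = refl
    ∑-map f (x ∷ xs) g = cong (_+_ (g (f x))) (∑-map f xs g)

    ∑-concatMap : ∀ (f : B → List C) xs (g : C → ℤ) → ∑ (concatMap f xs) g ≡ ∑ xs (λ x → ∑ (f x) g)
    ∑-concatMap f []       g = refl
    ∑-concatMap f (x ∷ xs) g = trans (∑-++ (f x) _ g) (cong (_+_ (∑ (f x) g)) (∑-concatMap f xs g))

ind : Bool → ℤ
ind b = if b then + 1 else + 0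

ind-∧ : ∀ a b → ind (a ∧ b) ≡ ind a * ind b
ind-∧ false b = refl
ind-∧ true  b = sym (ℤ.*-identityˡ (ind b))

antidiagonal : ℕ → List (ℕ × ℕ)
antidiagonal zero    = (0 , 0) ∷ []
antidiagonal (suc k) = (0 , suc k) ∷ map (λ (i , j) → suc i , j) (antidiagonal k)

∑A : ℕ → (ℕ → ℕ → ℤ) → ℤ
∑A k g = ∑ (antidiagonal k) (λ (i , j) → g i j)

∑A-suc : ∀ k g → ∑A (suc k) g ≡ g 0 (suc k) + ∑A k (λ i j → g (suc i) j)
∑A-suc k g = trans (∑-∷ _ _ _) (cong (_+_ (g 0 (suc k))) (∑-map _ (antidiagonal k) _))

∑A-zero : ∀ g → ∑A 0 g ≡ g 0 0
∑A-zero g = ∑-[x] _ _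

∑A-cong : ∀ k {g h : ℕ → ℕ → ℤ} → (∀ i j → i ℕ.+ j ≡ k → g i j ≡ h i j) → ∑A k g ≡ ∑A k h
∑A-cong zero {g} {h} e = trans (∑A-zero g) (trans (e 0 0 refl) (sym (∑A-zero h)))
∑A-cong (suc k) {g} {h} e = begin
  ∑A (suc k) g                                ≡⟨ ∑A-suc k g ⟩
  g 0 (suc k) + ∑A k (λ i j → g (suc i) j)    ≡⟨ cong₂ _+_ (e 0 (suc k) refl) (∑A-cong k λ i j q → e (suc i) j (cong suc q)) ⟩
  h 0 (suc k) + ∑A k (λ i j → h (suc i) j)    ≡⟨ ∑A-suc k h ⟨
  ∑A (suc k) h                                ∎

∑A-sucʳ : ∀ k g → ∑A (suc k) g ≡ ∑A k (λ i j → g i (suc j)) + g (suc k) 0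
∑A-sucʳ zero    g = begin
  ∑A 1 g                                  ≡⟨ ∑A-suc 0 g ⟩
  g 0 1 + ∑A 0 (λ i j → g (suc i) j)      ≡⟨ cong₂ _+_ (sym (∑A-zero _)) (∑A-zero _) ⟩
  ∑A 0 (λ i j → g i (suc j)) + g 1 0      ∎
∑A-sucʳ (suc k) g = begin
  ∑A (suc (suc k)) g
    ≡⟨ ∑A-suc (suc k) g ⟩
  g 0 (suc (suc k)) + ∑A (suc k) (λ i j → g (suc i) j)
    ≡⟨ cong (_+_ (g 0 (suc (suc k)))) (∑A-sucʳ k (λ i j → g (suc i) j)) ⟩
  g 0 (suc (suc k)) + (∑A k (λ i j → g (suc i) (suc j)) + g (suc (suc k)) 0)
    ≡⟨ ℤ.+-assoc (g 0 (suc (suc k))) _ _ ⟨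
  g 0 (suc (suc k)) + ∑A k (λ i j → g (suc i) (suc j)) + g (suc (suc k)) 0
    ≡⟨ cong (_+ g (suc (suc k)) 0) (∑A-suc k (λ i j → g i (suc j))) ⟨
  ∑A (suc k) (λ i j → g i (suc j)) + g (suc (suc k)) 0 ∎

∑A-flip : ∀ k g → ∑A k (λ i j → g j i) ≡ ∑A k g
∑A-flip zero    g = trans (∑A-zero _) (sym (∑A-zero g))
∑A-flip (suc k) g = begin
  ∑A (suc k) (λ i j → g j i)                       ≡⟨ ∑A-suc k (λ i j → g j i) ⟩
  g (suc k) 0 + ∑A k (λ i j → g j (suc i))         ≡⟨ cong (_+_ (g (suc k) 0)) (∑A-flip k (λ i j → g i (suc j))) ⟩
  g (suc k) 0 + ∑A k (λ i j → g i (suc j))         ≡⟨ ℤ.+-comm (g (suc k) 0) _ ⟩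
  ∑A k (λ i j → g i (suc j)) + g (suc k) 0         ≡⟨ ∑A-sucʳ k g ⟨
  ∑A (suc k) g                                     ∎

∑A-1 : ∀ k → ∑A k (λ _ _ → + 1) ≡ + suc k
∑A-1 zero    = ∑A-zero _
∑A-1 (suc k) = trans (∑A-suc k (λ _ _ → + 1)) (cong (_+_ (+ 1)) (∑A-1 k))

cuts : {A : Set} → List A → List (List A × A × List A)
cuts []      = []
cuts (x ∷ u) = ([] , x , u) ∷ map (λ (v , y , w) → x ∷ v , y , w) (cuts u)

module _ {A : Set} where

  ∑C : List A → (List A → A → List A → ℤ) → ℤ
  ∑C u h = ∑ (cuts u) (λ (v , x , w) → h v x w)

  ∑C-∷ : ∀ x u h → ∑C (x ∷ u) h ≡ h [] x u + ∑C u (λ v → h (x ∷ v))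
  ∑C-∷ x u h = trans (∑-∷ _ _ _) (cong (_+_ (h [] x u)) (∑-map _ (cuts u) _))

  ∑C-[] : ∀ h → ∑C [] h ≡ + 0
  ∑C-[] h = ∑-[] _

  ∑C-cong : ∀ u {g h : List A → A → List A → ℤ} → (∀ v x w → v ++ x ∷ w ≡ u → g v x w ≡ h v x w) → ∑C u g ≡ ∑C u h
  ∑C-cong []      {g} {h} e = trans (∑C-[] g) (sym (∑C-[] h))
  ∑C-cong (x ∷ u) {g} {h} e = begin
    ∑C (x ∷ u) g                        ≡⟨ ∑C-∷ x u g ⟩
    g [] x u + ∑C u (λ v → g (x ∷ v))   ≡⟨ cong₂ _+_ (e [] x u refl) (∑C-cong u λ v y w q → e (x ∷ v) y w (cong (x ∷_) q)) ⟩
    h [] x u + ∑C u (λ v → h (x ∷ v))   ≡⟨ ∑C-∷ x u h ⟨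
    ∑C (x ∷ u) h                        ∎

module Words {A : Set} (as : List A) where

  words : ℕ → List (List A)
  words zero    = [] ∷ []
  words (suc k) = concatMap (λ x → map (x ∷_) (words k)) as

  ∑W : ℕ → (List A → ℤ) → ℤ
  ∑W k = ∑ (words k)

  ∑W-zero : ∀ h → ∑W 0 h ≡ h []
  ∑W-zero h = ∑-[x] [] h

  ∑W-suc : ∀ k h → ∑W (suc k) h ≡ ∑ as (λ x → ∑W k (λ u → h (x ∷ u)))
  ∑W-suc k h = trans (∑-concatMap _ as h) (∑-cong as λ x → ∑-map (x ∷_) (words k) h)

  ∑W-++ : ∀ i j h → ∑W i (λ u → ∑W j (λ v → h (u ++ v))) ≡ ∑W (i ℕ.+ j) h
  ∑W-++ zero    j h = ∑W-zero _
  ∑W-++ (suc i) j h = begin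
    ∑W (suc i) (λ u → ∑W j (λ v → h (u ++ v)))
      ≡⟨ ∑W-suc i _ ⟩
    ∑ as (λ x → ∑W i (λ u → ∑W j (λ v → h (x ∷ u ++ v))))
      ≡⟨ ∑-cong as (λ x → ∑W-++ i j (λ u → h (x ∷ u))) ⟩
    ∑ as (λ x → ∑W (i ℕ.+ j) (λ u → h (x ∷ u)))
      ≡⟨ ∑W-suc (i ℕ.+ j) h ⟨
    ∑W (suc i ℕ.+ j) h ∎

  ∑W-∷ʳ : ∀ k h → ∑W (suc k) h ≡ ∑ as (λ x → ∑W k (λ u → h (u ∷ʳ x)))
  ∑W-∷ʳ k h = begin
    ∑W (suc k) h                                 ≡⟨ cong (λ m → ∑W m h) (ℕ.+-comm 1 k) ⟩
    ∑W (k ℕ.+ 1) h                               ≡⟨ ∑W-++ k 1 h ⟨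
    ∑W k (λ u → ∑W 1 (λ v → h (u ++ v)))         ≡⟨ ∑-cong (words k) (λ u → trans (∑W-suc 0 _) (∑-cong as λ x → ∑W-zero _)) ⟩
    ∑W k (λ u → ∑ as (λ x → h (u ∷ʳ x)))         ≡⟨ ∑-swap (words k) as _ ⟩
    ∑ as (λ x → ∑W k (λ u → h (u ∷ʳ x)))         ∎

  -- Double counting of words with a marked letter, sorted by the position of the mark. This is what
  -- lets a sum over words recurse into the two sides of a cut.
  ∑W-cuts : ∀ k h → ∑W (suc k) (λ u → ∑C u h) ≡
            ∑A k (λ i j → ∑ as (λ x → ∑W i (λ v → ∑W j (λ w → h v x w))))
  ∑W-cuts zero h = begin
    ∑W 1 (λ u → ∑C u h)
      ≡⟨ ∑W-suc 0 _ ⟩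
    ∑ as (λ x → ∑W 0 (λ u → ∑C (x ∷ u) h))
      ≡⟨ ∑-cong as (λ x → trans (∑W-zero _) (∑-[x] _ _)) ⟩
    ∑ as (λ x → h [] x [])
      ≡⟨ ∑-cong as (λ x → trans (∑W-zero _) (∑W-zero _)) ⟨
    ∑ as (λ x → ∑W 0 (λ v → ∑W 0 (λ w → h v x w)))
      ≡⟨ ∑A-zero _ ⟨
    ∑A 0 (λ i j → ∑ as (λ x → ∑W i (λ v → ∑W j (λ w → h v x w)))) ∎
  ∑W-cuts (suc k) h = begin
    ∑W (suc (suc k)) (λ u → ∑C u h)
      ≡⟨ ∑W-suc (suc k) _ ⟩
    ∑ as (λ x → ∑W (suc k) (λ u → ∑C (x ∷ u) h))
      ≡⟨ ∑-cong as (λ x → trans (∑-cong (words (suc k)) (λ u → ∑C-∷ x u h)) (∑-+ (words (suc k)) _ _)) ⟩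
    ∑ as (λ x → ∑W (suc k) (λ u → h [] x u) + ∑W (suc k) (λ u → ∑C u (λ v → h (x ∷ v))))
      ≡⟨ ∑-+ as _ _ ⟩
    ∑ as (λ x → ∑W (suc k) (λ u → h [] x u)) + ∑ as (λ x → ∑W (suc k) (λ u → ∑C u (λ v → h (x ∷ v))))
      ≡⟨ cong₂ _+_ (∑-cong as λ x → sym (∑W-zero _)) tail ⟩
    ∑ as (λ x → ∑W 0 (λ v → ∑W (suc k) (λ w → h v x w)))
      + ∑A k (λ i j → ∑ as (λ y → ∑W (suc i) (λ v → ∑W j (λ w → h v y w))))
      ≡⟨ ∑A-suc k (λ i j → ∑ as (λ x → ∑W i (λ v → ∑W j (λ w → h v x w)))) ⟨
    ∑A (suc k) (λ i j → ∑ as (λ x → ∑W i (λ v → ∑W j (λ w → h v x w)))) ∎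
    where
    tail : ∑ as (λ x → ∑W (suc k) (λ u → ∑C u (λ v → h (x ∷ v)))) ≡
           ∑A k (λ i j → ∑ as (λ y → ∑W (suc i) (λ v → ∑W j (λ w → h v y w))))
    tail = begin
      ∑ as (λ x → ∑W (suc k) (λ u → ∑C u (λ v → h (x ∷ v))))
        ≡⟨ ∑-cong as (λ x → ∑W-cuts k (λ v → h (x ∷ v))) ⟩
      ∑ as (λ x → ∑A k (λ i j → ∑ as (λ y → ∑W i (λ v → ∑W j (λ w → h (x ∷ v) y w)))))
        ≡⟨ ∑-swap as (antidiagonal k) _ ⟩
      ∑A k (λ i j → ∑ as (λ x → ∑ as (λ y → ∑W i (λ v → ∑W j (λ w → h (x ∷ v) y w)))))
        ≡⟨ ∑A-cong k (λ i j _ → trans (∑-swap as as _) (∑-cong as λ y → sym (∑W-suc i _))) ⟩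
      ∑A k (λ i j → ∑ as (λ y → ∑W (suc i) (λ v → ∑W j (λ w → h v y w)))) ∎

-- Symmetric sums over a single run

all-++ : {A : Set} (b : A → Bool) (u v : List A) → all b (u ++ v) ≡ all b u ∧ all b v
all-++ b []      v = refl
all-++ b (x ∷ u) v with b x
... | false = refl
... | true  = all-++ b u v

module _ {A : Set} where

  AllPairs-++ˡ : {R : A → A → Set} (u : List A) {v : List A} → AllPairs R (u ++ v) → AllPairs R u
  AllPairs-++ˡ []      ps       = []
  AllPairs-++ˡ (x ∷ u) (p ∷ ps) = All.++⁻ˡ u p ∷ AllPairs-++ˡ u ps

  AllPairs-++ʳ : {R : A → A → Set} (u : List A) {v : List A} → AllPairs R (u ++ v) → AllPairs R v
  AllPairs-++ʳ []      ps       = ps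
  AllPairs-++ʳ (x ∷ u) (p ∷ ps) = AllPairs-++ʳ u ps

  -- Models the indicator of the linear extensions, with values in `ℤ` so that the class is closed
  -- under scaling, fixing a prefix or suffix, and restricting the letters. `support` is there
  -- because only a word without repetitions is sure to have a dominating letter.
  record Symmetric (sgn : A → Bool) (χ : List A → ℤ) : Set where
    field
      swap    : ∀ u {x y} v → sgn x ≡ sgn y → χ (u ++ x ∷ y ∷ v) ≡ χ (u ++ y ∷ x ∷ v)
      support : ∀ u → χ u ≡ + 0 ⊎ AllPairs _≢_ u

  open Symmetric

  FullySymmetric : (List A → ℤ) → Set
  FullySymmetric = Symmetric (λ _ → true)

  module _ {sgn : A → Bool} {χ : List A → ℤ} (sχ : Symmetric sgn χ) where

    prefix-sym : ∀ p → Symmetric sgn (λ w → χ (p ++ w))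
    prefix-sym p .swap u {x} {y} v e = begin
      χ (p ++ u ++ x ∷ y ∷ v)     ≡⟨ cong χ (++-assoc p u _) ⟨
      χ ((p ++ u) ++ x ∷ y ∷ v)   ≡⟨ swap sχ (p ++ u) v e ⟩
      χ ((p ++ u) ++ y ∷ x ∷ v)   ≡⟨ cong χ (++-assoc p u _) ⟩
      χ (p ++ u ++ y ∷ x ∷ v)     ∎
    prefix-sym p .support u with support sχ (p ++ u)
    ... | inj₁ z = inj₁ z
    ... | inj₂ d = inj₂ (AllPairs-++ʳ p d)

    suffix-sym : ∀ q → Symmetric sgn (λ v → χ (v ++ q))
    suffix-sym q .swap u {x} {y} v e = begin
      χ ((u ++ x ∷ y ∷ v) ++ q)   ≡⟨ cong χ (++-assoc u _ q) ⟩
      χ (u ++ x ∷ y ∷ v ++ q)     ≡⟨ swap sχ u (v ++ q) e ⟩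
      χ (u ++ y ∷ x ∷ v ++ q)     ≡⟨ cong χ (++-assoc u _ q) ⟨
      χ ((u ++ y ∷ x ∷ v) ++ q)   ∎
    suffix-sym q .support u with support sχ (u ++ q)
    ... | inj₁ z = inj₁ z
    ... | inj₂ d = inj₂ (AllPairs-++ˡ u d)

    scale-sym : ∀ k → Symmetric sgn (λ u → k * χ u)
    scale-sym k .swap u v e = cong (k *_) (swap sχ u v e)
    scale-sym k .support u with support sχ u
    ... | inj₁ z = inj₁ (trans (cong (k *_) z) (ℤ.*-zeroʳ k))
    ... | inj₂ d = inj₂ d

  all-swap : ∀ (b : A → Bool) u {x y} v → all b (u ++ x ∷ y ∷ v) ≡ all b (u ++ y ∷ x ∷ v)
  all-swap b []      {x} {y} v with b x | b y
  ... | false | false = refl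
  ... | false | true  = refl
  ... | true  | false = refl
  ... | true  | true  = refl
  all-swap b (z ∷ u) v = cong (b z ∧_) (all-swap b u v)

  restrict-sym : ∀ {sgn χ} → Symmetric sgn χ → ∀ b → Symmetric sgn (λ u → ind (all b u) * χ u)
  restrict-sym sχ b .swap u v e = cong₂ _*_ (cong ind (all-swap b u v)) (swap sχ u v e)
  restrict-sym sχ b .support u with support sχ u
  ... | inj₁ z = inj₁ (trans (cong (ind (all b u) *_) z) (ℤ.*-zeroʳ (ind (all b u))))
  ... | inj₂ d = inj₂ d

  to-front : ∀ {χ} → FullySymmetric χ → ∀ v x w → χ (v ++ x ∷ w) ≡ χ (x ∷ v ++ w)
  to-front         sχ []      x w = refl
  to-front {χ = χ} sχ (y ∷ v) x w = begin
    χ (y ∷ v ++ x ∷ w)   ≡⟨ to-front (prefix-sym sχ (y ∷ [])) v x w ⟩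
    χ (y ∷ x ∷ v ++ w)   ≡⟨ swap sχ [] (v ++ w) refl ⟩
    χ (x ∷ y ∷ v ++ w)   ∎

  record StrictTotal (D : A → A → Bool) : Set where
    field
      asym  : ∀ x y → D x y ≡ true → D y x ≡ false
      trns  : ∀ x y z → D x y ≡ true → D y z ≡ true → D x z ≡ true
      total : ∀ x y → x ≢ y → D x y ≡ false → D y x ≡ true

  open StrictTotal

  module _ {D : A → A → Bool} (ord : StrictTotal D) where

    top : List A → A → List A → ℤ
    top v x w = ind (all (D x) v) * ind (all (D x) w)

    all-trns : ∀ a x u → D a x ≡ true → all (D x) u ≡ true → all (D a) u ≡ true
    all-trns a x []      p q = refl
    all-trns a x (y ∷ u) p q with D x y in xy
    ... | true rewrite trns ord a x y p xy = all-trns a x u p q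

    -- If `x` dominates the rest of its word, then after `a` is prepended exactly one of `a` and `x`
    -- dominates, which accounts for the two summands. Otherwise every term vanishes.
    top-step : ∀ a v x w → a ≢ x →
               ind (all (D a) (v ++ x ∷ w)) * top v x w + top (a ∷ v) x w ≡ top v x w
    top-step a v x w a≢x rewrite all-++ (D a) v (x ∷ w)
      with all (D x) v in ev | all (D x) w in ew
    ... | false | _ with D x a
    ...   | false = cong (_+ + 0) (ℤ.*-zeroʳ (ind (all (D a) v ∧ D a x ∧ all (D a) w)))
    ...   | true  = cong (_+ + 0) (ℤ.*-zeroʳ (ind (all (D a) v ∧ D a x ∧ all (D a) w)))
    top-step a v x w a≢x | true | false with D x a
    ...   | false = cong (_+ + 0) (ℤ.*-zeroʳ (ind (all (D a) v ∧ D a x ∧ all (D a) w)))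
    ...   | true  = cong (_+ + 0) (ℤ.*-zeroʳ (ind (all (D a) v ∧ D a x ∧ all (D a) w)))
    top-step a v x w a≢x | true | true with D x a in xa
    ...   | true rewrite asym ord x a xa with all (D a) v
    ...     | false = refl
    ...     | true  = refl
    top-step a v x w a≢x | true | true | false
      rewrite total ord x a (λ e → a≢x (sym e)) xa
            | all-trns a x v (total ord x a (λ e → a≢x (sym e)) xa) ev
            | all-trns a x w (total ord x a (λ e → a≢x (sym e)) xa) ew = refl

    -- The cut at `a` is multiplied by the sum over the tail, known to be 1; it thus spreads over
    -- the cuts of the tail, where `top-step` absorbs it.
    unique-top : ∀ a u → AllPairs _≢_ (a ∷ u) → ∑C (a ∷ u) top ≡ + 1
    unique-top a []      d        = ∑-[x] _ _
    unique-top a (b ∷ u) (na ∷ d) = begin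
      ∑C (a ∷ b ∷ u) top
        ≡⟨ ∑C-∷ a (b ∷ u) top ⟩
      + 1 * ind (all (D a) (b ∷ u)) + ∑C (b ∷ u) (λ v → top (a ∷ v))
        ≡⟨ cong (_+ ∑C (b ∷ u) (λ v → top (a ∷ v))) (reorder (ind (all (D a) (b ∷ u)))) ⟩
      ind (all (D a) (b ∷ u)) * + 1 + ∑C (b ∷ u) (λ v → top (a ∷ v))
        ≡⟨ cong (λ z → ind (all (D a) (b ∷ u)) * z + ∑C (b ∷ u) (λ v → top (a ∷ v))) (unique-top b u d) ⟨
      ind (all (D a) (b ∷ u)) * ∑C (b ∷ u) top + ∑C (b ∷ u) (λ v → top (a ∷ v))
        ≡⟨ cong (_+ ∑C (b ∷ u) (λ v → top (a ∷ v))) (∑-*ˡ (cuts (b ∷ u)) (ind (all (D a) (b ∷ u))) _) ⟩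
      ∑C (b ∷ u) (λ v x w → ind (all (D a) (b ∷ u)) * top v x w) + ∑C (b ∷ u) (λ v → top (a ∷ v))
        ≡⟨ ∑-+ (cuts (b ∷ u)) _ _ ⟨
      ∑C (b ∷ u) (λ v x w → ind (all (D a) (b ∷ u)) * top v x w + top (a ∷ v) x w)
        ≡⟨ ∑C-cong (b ∷ u) step ⟩
      ∑C (b ∷ u) top
        ≡⟨ unique-top b u d ⟩
      + 1 ∎
      where
      reorder : ∀ z → + 1 * z ≡ z * + 1
      reorder = solve-∀
      step : ∀ v x w → v ++ x ∷ w ≡ b ∷ u → _
      step v x w e = trans (cong (λ z → ind (all (D a) z) * top v x w + top (a ∷ v) x w) (sym e))
        (top-step a v x w (All.head (All.++⁻ʳ v (subst (All (a ≢_)) (sym e) na))))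

  -- The coefficient of a cut sees the pieces only through their lengths, so it can be pulled out of
  -- a sum over all pieces of given lengths. `cut` is demanded at dominating letters only.
  record BlockWeight (c : ℕ → ℕ → ℤ) (f : List A → ℤ) : Set where
    field
      D     : A → A → Bool
      ord   : StrictTotal D
      empty : f [] ≡ + 1
      cut   : ∀ v x w → all (D x) v ≡ true → all (D x) w ≡ true →
              f (v ++ x ∷ w) ≡ c (length v) (length w) * (f v * f w)

  open BlockWeight

module _ {A : Set} (as : List A) where
  open Words as
  open Symmetric
  open BlockWeight

  ∑W-cong : ∀ k {g h : List A → ℤ} → (∀ u → length u ≡ k → g u ≡ h u) → ∑W k g ≡ ∑W k h
  ∑W-cong zero {g} {h} e = trans (∑W-zero g) (trans (e [] refl) (sym (∑W-zero h)))
  ∑W-cong (suc k) {g} {h} e = begin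
    ∑W (suc k) g                               ≡⟨ ∑W-suc k g ⟩
    ∑ as (λ x → ∑W k (λ u → g (x ∷ u)))        ≡⟨ ∑-cong as (λ x → ∑W-cong k λ u q → e (x ∷ u) (cong suc q)) ⟩
    ∑ as (λ x → ∑W k (λ u → h (x ∷ u)))        ≡⟨ ∑W-suc k h ⟨
    ∑W (suc k) h                               ∎

  module _ {D : A → A → Bool} (ord : StrictTotal D) {χ : List A → ℤ} (sχ : FullySymmetric χ) where

    -- Each word is multiplied by the 1 of `unique-top`, and the sum is reordered by the position of
    -- the dominating letter. Words with repetitions are harmless because χ vanishes on them.
    peel : ∀ m (g : List A → ℤ) → ∑W (suc m) (λ u → χ u * g u) ≡
           ∑A m (λ i j → ∑ as λ x → ∑W i λ v → ∑W j λ w → top ord v x w * (χ (v ++ x ∷ w) * g (v ++ x ∷ w)))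
    peel m g = trans (∑W-cong (suc m) pointwise) (∑W-cuts m _)
      where
      pointwise : ∀ u → length u ≡ suc m → χ u * g u ≡ ∑C u (λ v x w → top ord v x w * (χ (v ++ x ∷ w) * g (v ++ x ∷ w)))
      pointwise (a ∷ u) _ = begin
        χ (a ∷ u) * g (a ∷ u)                       ≡⟨ insert (support sχ (a ∷ u)) ⟩
        ∑C (a ∷ u) (top ord) * (χ (a ∷ u) * g (a ∷ u))    ≡⟨ ∑-*ʳ (cuts (a ∷ u)) _ _ ⟩
        ∑C (a ∷ u) (λ v x w → top ord v x w * (χ (a ∷ u) * g (a ∷ u)))
          ≡⟨ ∑C-cong (a ∷ u) (λ v x w e → cong (λ z → top ord v x w * (χ z * g z)) (sym e)) ⟩
        ∑C (a ∷ u) (λ v x w → top ord v x w * (χ (v ++ x ∷ w) * g (v ++ x ∷ w))) ∎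
        where
        insert : χ (a ∷ u) ≡ + 0 ⊎ AllPairs _≢_ (a ∷ u) → χ (a ∷ u) * g (a ∷ u) ≡ ∑C (a ∷ u) (top ord) * (χ (a ∷ u) * g (a ∷ u))
        insert (inj₁ z) rewrite z = sym (ℤ.*-zeroʳ (∑C (a ∷ u) (top ord)))
        insert (inj₂ d) rewrite unique-top ord a u d = sym (ℤ.*-identityˡ _)

    leading : ℕ → ℤ
    leading m = ∑ as λ x → ∑W m λ z → ind (all (D x) z) * χ (x ∷ z)

    -- Symmetry moves the dominating letter to the front, so every position has the same share of
    -- the sum of χ.
    collapse : ∀ m i j → i ℕ.+ j ≡ m →
               ∑ as (λ x → ∑W i λ v → ∑W j λ w → top ord v x w * χ (v ++ x ∷ w)) ≡ leading m
    collapse _ i j refl = ∑-cong as λ x → trans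
      (∑-cong (words i) λ v → ∑-cong (words j) λ w → cong₂ _*_
        (trans (sym (ind-∧ (all (D x) v) (all (D x) w))) (cong ind (sym (all-++ (D x) v w))))
        (to-front sχ v x w))
      (∑W-++ i j (λ z → ind (all (D x) z) * χ (x ∷ z)))

    -- `peel` with the constant weight 1: each of the `suc m` positions of the dominating letter
    -- contributes one equal share.
    total-leading : ∀ m → ∑W (suc m) χ ≡ + suc m * leading m
    total-leading m = begin
      ∑W (suc m) χ                           ≡⟨ ∑-cong (words (suc m)) (λ u → sym (ℤ.*-identityʳ (χ u))) ⟩
      ∑W (suc m) (λ u → χ u * + 1)           ≡⟨ peel m (λ _ → + 1) ⟩
      _                                      ≡⟨ ∑A-cong m (λ i j e → trans
                                                  (∑-cong as λ x → ∑-cong (words i) λ v → ∑-cong (words j) λ w →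
                                                    cong (top ord v x w *_) (ℤ.*-identityʳ (χ (v ++ x ∷ w))))
                                                  (trans (collapse m i j e) (sym (ℤ.*-identityˡ _)))) ⟩
      ∑A m (λ _ _ → + 1 * leading m)         ≡⟨ ∑-*ʳ (antidiagonal m) (leading m) _ ⟨
      ∑A m (λ _ _ → + 1) * leading m         ≡⟨ cong (_* leading m) (∑A-1 m) ⟩
      + suc m * leading m                    ∎

  -- For a symmetric χ the mean of f against χ does not depend on χ: it is C i / K, for every
  -- admissible order and weight with the given symmetrised cut coefficients γ.
  Means : (γ : ℕ → ℕ → ℤ) → ℕ → ℤ → (ℕ → ℤ) → Set
  Means γ m K C = ∀ i → i ≤ m → ∀ {c f} → BlockWeight c f → (∀ i j → c i j + c j i ≡ γ i j) →
                  ∀ {χ} → FullySymmetric χ → K * ∑W i (λ u → χ u * f u) ≡ C i * ∑W i χ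

  module _ {γ : ℕ → ℕ → ℤ} {m K C} (means : Means γ m K C) where

    -- After the cut at the dominating letter both pieces are again summed against symmetric
    -- functions, so both means are known and cost one `K` each. A position then contributes
    -- `c i j * (C i * C j)` times a share that is the same for all positions.
    mean-next : ∀ {c f} → BlockWeight c f → (∀ i j → c i j + c j i ≡ γ i j) → ∀ {χ} → FullySymmetric χ →
                (+ 2 * + suc m * (K * K)) * ∑W (suc m) (λ u → χ u * f u) ≡
                ∑A m (λ i j → γ i j * (C i * C j)) * ∑W (suc m) χ
    mean-next {c} {f} bw cγ {χ} sχ = begin
      (+ 2 * + suc m * (K * K)) * ∑W (suc m) (λ u → χ u * f u)
        ≡⟨ cong ((+ 2 * + suc m * (K * K)) *_) (peel (ord bw) sχ m f) ⟩
      (+ 2 * + suc m * (K * K)) * ∑A m T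
        ≡⟨ ℤ.*-assoc (+ 2 * + suc m) (K * K) _ ⟩
      (+ 2 * + suc m) * (K * K * ∑A m T)
        ≡⟨ cong ((+ 2 * + suc m) *_) (trans (∑-*ˡ (antidiagonal m) (K * K) _) (trans (∑A-cong m term) (sym (∑-*ʳ (antidiagonal m) X _)))) ⟩
      (+ 2 * + suc m) * (∑A m (λ i j → c i j * (C i * C j)) * X)
        -- The 2 pays for adding the sum to its mirror image, which turns `c` into γ; `suc m`
        -- restores the full sum of χ from one share.
        ≡⟨ regroup (+ suc m) (∑A m (λ i j → c i j * (C i * C j))) X ⟩
      (∑A m (λ i j → c i j * (C i * C j)) + ∑A m (λ i j → c i j * (C i * C j))) * (+ suc m * X)
        ≡⟨ cong₂ _*_ symmetrise (sym (total-leading (ord bw) sχ m)) ⟩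
      ∑A m (λ i j → γ i j * (C i * C j)) * ∑W (suc m) χ ∎
      where
      X = leading (ord bw) sχ m
      δ = top (ord bw)
      T : ℕ → ℕ → ℤ
      T i j = ∑ as λ x → ∑W i λ v → ∑W j λ w → δ v x w * (χ (v ++ x ∷ w) * f (v ++ x ∷ w))

      regroup : ∀ n a x → (+ 2 * n) * (a * x) ≡ (a + a) * (n * x)
      regroup = solve-∀

      symmetrise : ∑A m (λ i j → c i j * (C i * C j)) + ∑A m (λ i j → c i j * (C i * C j)) ≡ ∑A m (λ i j → γ i j * (C i * C j))
      symmetrise = begin
        ∑A m (λ i j → c i j * (C i * C j)) + ∑A m (λ i j → c i j * (C i * C j))
          ≡⟨ cong (_+_ (∑A m (λ i j → c i j * (C i * C j)))) (∑A-flip m (λ i j → c i j * (C i * C j))) ⟨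
        ∑A m (λ i j → c i j * (C i * C j)) + ∑A m (λ i j → c j i * (C j * C i))
          ≡⟨ ∑-+ (antidiagonal m) _ _ ⟨
        ∑A m (λ i j → c i j * (C i * C j) + c j i * (C j * C i))
          ≡⟨ ∑A-cong m (λ i j _ → trans (collect (c i j) (c j i) (C i) (C j)) (cong (_* (C i * C j)) (cγ i j))) ⟩
        ∑A m (λ i j → γ i j * (C i * C j)) ∎
        where
        collect : ∀ a b p q → a * (p * q) + b * (q * p) ≡ (a + b) * (p * q)
        collect = solve-∀

      term : ∀ i j → i ℕ.+ j ≡ m → K * K * T i j ≡ c i j * (C i * C j) * X
      term i j e = begin
        K * K * T i j
          ≡⟨ ∑-*ˡ as (K * K) _ ⟩
        ∑ as (λ x → K * K * ∑W i (λ v → ∑W j (λ w → δ v x w * (χ (v ++ x ∷ w) * f (v ++ x ∷ w)))))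
          ≡⟨ ∑-cong as inner ⟩
        ∑ as (λ x → c i j * (C i * C j) * ∑W i (λ v → ∑W j (λ w → δ v x w * χ (v ++ x ∷ w))))
          ≡⟨ ∑-*ˡ as (c i j * (C i * C j)) _ ⟨
        c i j * (C i * C j) * ∑ as (λ x → ∑W i (λ v → ∑W j (λ w → δ v x w * χ (v ++ x ∷ w))))
          ≡⟨ cong (c i j * (C i * C j) *_) (collapse (ord bw) sχ m i j e) ⟩
        c i j * (C i * C j) * X ∎
        where
        i≤m : i ≤ m
        i≤m = subst (i ≤_) e (ℕ.m≤m+n i j)
        j≤m : j ≤ m
        j≤m = subst (j ≤_) e (ℕ.m≤n+m j i)
        inner : ∀ x → K * K * ∑W i (λ v → ∑W j (λ w → δ v x w * (χ (v ++ x ∷ w) * f (v ++ x ∷ w)))) ≡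
                      c i j * (C i * C j) * ∑W i (λ v → ∑W j (λ w → δ v x w * χ (v ++ x ∷ w)))
        inner x = begin
          K * K * ∑W i (λ v → ∑W j (λ w → δ v x w * (χ (v ++ x ∷ w) * f (v ++ x ∷ w))))
            ≡⟨ cong (K * K *_) (∑W-cong i λ v lv → trans (∑W-cong j λ w lw → split v w lv lw)
                 (sym (∑-*ˡ (words j) (c i j * (b v * f v)) _))) ⟩
          K * K * ∑W i (λ v → c i j * (b v * f v) * ∑W j (λ w → b w * χ (v ++ x ∷ w) * f w))
            ≡⟨ trans (ℤ.*-assoc K K _) (cong (K *_) (∑-*ˡ (words i) K _)) ⟩
          K * ∑W i (λ v → K * (c i j * (b v * f v) * ∑W j (λ w → b w * χ (v ++ x ∷ w) * f w)))
            -- With `v` and `x` fixed, χ restricted to letters dominated by `x` is fully symmetric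
            -- in `w`, so the mean over `w` applies.
            ≡⟨ cong (K *_) (∑-cong (words i) λ v → trans
                 (shuffle₁ K (c i j) (b v) (f v) (∑W j (λ w → b w * χ (v ++ x ∷ w) * f w)))
                 (cong (c i j * (b v * f v) *_)
                   (means j j≤m bw cγ (restrict-sym (prefix-sym (prefix-sym sχ v) (x ∷ [])) (D bw x))))) ⟩
          K * ∑W i (λ v → c i j * (b v * f v) * (C j * ∑W j (λ w → b w * χ (v ++ x ∷ w))))
            ≡⟨ cong (K *_) (∑-cong (words i) λ v → trans
                 (shuffle₂ (c i j) (b v) (f v) (C j) (∑W j (λ w → b w * χ (v ++ x ∷ w))))
                 (cong (c i j * C j *_) (∑-*ˡ (words j) (b v * f v) _))) ⟩
          K * ∑W i (λ v → c i j * C j * ∑W j (λ w → b v * f v * (b w * χ (v ++ x ∷ w))))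
            ≡⟨ cong (K *_) (sym (∑-*ˡ (words i) (c i j * C j) _)) ⟩
          K * (c i j * C j * ∑W i (λ v → ∑W j (λ w → b v * f v * (b w * χ (v ++ x ∷ w)))))
            ≡⟨ cong (λ z → K * (c i j * C j * z)) (trans (∑-swap (words i) (words j) _)
                 (∑-cong (words j) λ w → ∑-cong (words i) λ v → shuffle₃ (b v) (f v) (b w) (χ (v ++ x ∷ w)))) ⟩
          K * (c i j * C j * ∑W j (λ w → ∑W i (λ v → b v * (b w * χ (v ++ x ∷ w)) * f v)))
            ≡⟨ shuffle₄ K (c i j * C j) _ ⟩
          c i j * C j * (K * ∑W j (λ w → ∑W i (λ v → b v * (b w * χ (v ++ x ∷ w)) * f v)))
            -- Now `w` is fixed and `b w` is a mere scalar, so the same argument gives the mean over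
            -- `v`.
            ≡⟨ cong (c i j * C j *_) (trans (∑-*ˡ (words j) K _) (∑-cong (words j) λ w →
                 means i i≤m bw cγ (restrict-sym (scale-sym (suffix-sym sχ (x ∷ w)) (b w)) (D bw x)))) ⟩
          c i j * C j * ∑W j (λ w → C i * ∑W i (λ v → b v * (b w * χ (v ++ x ∷ w))))
            ≡⟨ cong (c i j * C j *_) (sym (∑-*ˡ (words j) (C i) _)) ⟩
          c i j * C j * (C i * ∑W j (λ w → ∑W i (λ v → b v * (b w * χ (v ++ x ∷ w)))))
            ≡⟨ shuffle₅ (c i j) (C j) (C i) _ ⟩
          c i j * (C i * C j) * ∑W j (λ w → ∑W i (λ v → b v * (b w * χ (v ++ x ∷ w))))
            ≡⟨ cong (c i j * (C i * C j) *_) (trans (∑-swap (words j) (words i) _)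
                 (∑-cong (words i) λ v → ∑-cong (words j) λ w → sym (ℤ.*-assoc (b v) (b w) _))) ⟩
          c i j * (C i * C j) * ∑W i (λ v → ∑W j (λ w → δ v x w * χ (v ++ x ∷ w))) ∎
          where
          b : List A → ℤ
          b u = ind (all (D bw x) u)
          shuffle₁ : ∀ k c b f s → k * (c * (b * f) * s) ≡ c * (b * f) * (k * s)
          shuffle₁ = solve-∀
          shuffle₂ : ∀ c b f d s → c * (b * f) * (d * s) ≡ c * d * (b * f * s)
          shuffle₂ = solve-∀
          shuffle₃ : ∀ b f d s → b * f * (d * s) ≡ b * (d * s) * f
          shuffle₃ = solve-∀
          shuffle₄ : ∀ k c s → k * (c * s) ≡ c * (k * s)
          shuffle₄ = solve-∀
          shuffle₅ : ∀ c d e s → c * d * (e * s) ≡ c * (e * d) * s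
          shuffle₅ = solve-∀
          shuffle₆ : ∀ s c f g → + 1 * + 1 * (s * (c * (f * g))) ≡ c * (+ 1 * f) * (+ 1 * s * g)
          shuffle₆ = solve-∀
          split : ∀ v w → length v ≡ i → length w ≡ j →
                  δ v x w * (χ (v ++ x ∷ w) * f (v ++ x ∷ w)) ≡ c i j * (b v * f v) * (b w * χ (v ++ x ∷ w) * f w)
          split v w refl refl with all (D bw x) v in ev | all (D bw x) w in ew
          ... | true  | true  rewrite cut bw v x w ev ew = shuffle₆ (χ (v ++ x ∷ w)) (c i j) (f v) (f w)
          ... | false | d     = trans (ℤ.*-zeroˡ (χ (v ++ x ∷ w) * f (v ++ x ∷ w))) (sym (zeros (c i j) (f v) (ind d * χ (v ++ x ∷ w) * f w)))
            where
            zeros : ∀ c f s → c * (+ 0 * f) * s ≡ + 0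
            zeros = solve-∀
          ... | true  | false = trans (ℤ.*-zeroˡ (χ (v ++ x ∷ w) * f (v ++ x ∷ w))) (sym (zeros (c i j) (f v) (χ (v ++ x ∷ w)) (f w)))
            where
            zeros : ∀ c f s g → c * (+ 1 * f) * (+ 0 * s * g) ≡ + 0
            zeros = solve-∀

  -- The order of the quantifiers is the point: denominator and numerators are built from γ alone,
  -- before the order, the weight and χ are given.
  means : ∀ γ m → ∃ λ k → ∃ λ C → Means γ m (+ suc k) C
  means γ zero = 0 , (λ _ → + 1) , base
    where
    base : Means γ 0 (+ 1) (λ _ → + 1)
    base zero _ {f = f} bw _ {χ} _ = cong (+ 1 *_) (begin
      ∑W 0 (λ u → χ u * f u)   ≡⟨ ∑W-zero _ ⟩
      χ [] * f []              ≡⟨ cong (χ [] *_) (empty bw) ⟩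
      χ [] * + 1               ≡⟨ ℤ.*-identityʳ (χ []) ⟩
      χ []                     ≡⟨ ∑W-zero χ ⟨
      ∑W 0 χ                   ∎)
  means γ (suc m) with means γ m
  -- The predecessor is taken so that its successor evaluates to `K′`. One denominator serves all
  -- lengths up to `suc m`, so `C′` rescales the earlier numerators by 2 (m + 1) K.
  ... | k , C , H = ℕ.pred (2 ℕ.* suc m ℕ.* (suc k ℕ.* suc k)) , C′ , H′
    where
    K = + suc k
    K′ = + 2 * + suc m * (K * K)
    C′ : ℕ → ℤ
    C′ i with i ℕ.≤? m
    ... | yes _ = + 2 * + suc m * K * C i
    ... | no  _ = ∑A m (λ i j → γ i j * (C i * C j))
    regroup : ∀ n K s → + 2 * n * (K * K) * s ≡ + 2 * n * K * (K * s)
    regroup = solve-∀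
    H′ : Means γ (suc m) K′ C′
    H′ i i≤ {f = f} bw cγ {χ} sχ with i ℕ.≤? m
    ... | yes i≤m = begin
      K′ * ∑W i (λ u → χ u * f u)                         ≡⟨ regroup (+ suc m) K _ ⟩
      + 2 * + suc m * K * (K * ∑W i (λ u → χ u * f u))    ≡⟨ cong (+ 2 * + suc m * K *_) (H i i≤m bw cγ sχ) ⟩
      + 2 * + suc m * K * (C i * ∑W i χ)                  ≡⟨ ℤ.*-assoc (+ 2 * + suc m * K) (C i) _ ⟨
      + 2 * + suc m * K * C i * ∑W i χ                    ∎
    ... | no  i≰m with refl ← ℕ.≤-antisym i≤ (ℕ.≰⇒> i≰m) = mean-next {γ} {m} {K} {C} H bw cγ sχ

  -- Both weights have the same symmetrised coefficients, hence the same mean, and the positive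
  -- denominator cancels. Their dominance orders may differ.
  block-sum : ∀ m {c c′ f f′} → BlockWeight c f → BlockWeight c′ f′ →
              (∀ i j → c i j + c j i ≡ c′ i j + c′ j i) →
              ∀ {χ} → FullySymmetric χ → ∑W m (λ u → χ u * f u) ≡ ∑W m (λ u → χ u * f′ u)
  block-sum m {c} {c′} bw bw′ e sχ with means (λ i j → c′ i j + c′ j i) m
  ... | k , C , H = ℤ.*-cancelˡ-≡ (+ suc k) _ _
        (trans (H m ℕ.≤-refl bw e sχ) (sym (H m ℕ.≤-refl bw′ (λ _ _ → refl) sχ)))

-- Weights of words with several runs

open Symmetric
open StrictTotal
open BlockWeight

module _ {A : Set} (κ : Bool → Bool → ℤ) (up : A → A → Bool) (end : A → Bool) where

  -- Each letter contributes κ l r, where l and r tell whether its left and right neighbours are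
  -- larger; the first letter is given its l as an argument, and end x is r for a last letter x.
  weight : Bool → List A → ℤ
  weight l []          = + 1
  weight l (a ∷ [])    = κ l (end a)
  weight l (a ∷ b ∷ w) = κ l (up a b) * weight (not (up a b)) (b ∷ w)

-- The flag that the dominating letter of a run of sign `s` gets from a side of the given length:
-- `s` from the neighbour beyond the run if the side is empty, the opposite from a letter that it
-- dominates.
flipIf : Bool → ℕ → Bool
flipIf s zero    = s
flipIf s (suc _) = not s

module _ {A : Set} {up : A → A → Bool} (ord : StrictTotal up) where

  -- In a run of sign s the letter to cut at is the largest (s = true) or the smallest one.
  dominates : Bool → A → A → Bool
  dominates s x y = if s then up y x else up x y

  dominates-total : ∀ s → StrictTotal (dominates s)
  dominates-total true  = record { asym  = λ x y → asym ord y x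
                                 ; trns  = λ x y z p q → trns ord z y x q p
                                 ; total = λ x y n → total ord y x (λ e → n (sym e)) }
  dominates-total false = ord

  dominates⇒up : ∀ s x y → dominates s x y ≡ true → up y x ≡ s × up x y ≡ not s
  dominates⇒up true  x y p = p , asym ord y x p
  dominates⇒up false x y p = asym ord x y p , p

module _ {A : Set} (κ : Bool → Bool → ℤ) {up : A → A → Bool} (tot : StrictTotal up) (s : Bool) where

  private
    f : Bool → List A → ℤ
    f = weight κ up (λ _ → s)

  -- Seen from the right piece, the dominating letter is like the letter before the run: larger if
  -- the run is negative, smaller if it is positive. So the piece starts with the flag `s` again;
  -- this is why the extremum is chosen by sign.
  weight-∷ : ∀ l x w → all (dominates tot s x) w ≡ true → f l (x ∷ w) ≡ κ l (flipIf s (length w)) * f s w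
  weight-∷ l x []      p = sym (ℤ.*-identityʳ _)
  weight-∷ l x (b ∷ w) p with dominates tot s x b in xb
  ... | true rewrite proj₂ (dominates⇒up tot s x b xb) = cong (λ z → κ l (not s) * f z (b ∷ w)) (Bool.not-involutive s)

  -- The mirror image: the last letter of the left piece gets from `x` the flag `s`, the one that it
  -- would have at the end of the run, while `x` gets `not s` from it.
  weight-cut : ∀ l a v x w → all (dominates tot s x) (a ∷ v) ≡ true → all (dominates tot s x) w ≡ true →
               f l (a ∷ v ++ x ∷ w) ≡ f l (a ∷ v) * (κ (not s) (flipIf s (length w)) * f s w)
  weight-cut l a []      x w p q with dominates tot s x a in xa
  ... | true rewrite proj₁ (dominates⇒up tot s x a xa) = cong (κ l s *_) (weight-∷ (not s) x w q)
  weight-cut l a (b ∷ v) x w p q with dominates tot s x a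
  ... | true = begin
    κ l (up a b) * f (not (up a b)) (b ∷ v ++ x ∷ w)
      ≡⟨ cong (κ l (up a b) *_) (weight-cut (not (up a b)) b v x w p q) ⟩
    κ l (up a b) * (f (not (up a b)) (b ∷ v) * (κ (not s) (flipIf s (length w)) * f s w))
      ≡⟨ ℤ.*-assoc (κ l (up a b)) _ _ ⟨
    κ l (up a b) * f (not (up a b)) (b ∷ v) * (κ (not s) (flipIf s (length w)) * f s w) ∎

  weight-block : BlockWeight (λ i j → κ (flipIf s i) (flipIf s j)) (f s)
  weight-block .D     = dominates tot s
  weight-block .ord   = dominates-total tot s
  weight-block .empty = refl
  weight-block .cut []      x w p q = trans (weight-∷ s x w q) (cong (κ s (flipIf s (length w)) *_) (sym (ℤ.*-identityˡ _)))
  weight-block .cut (a ∷ v) x w p q = trans (weight-cut s a v x w p q) (comm (f s (a ∷ v)) (κ (not s) (flipIf s (length w))) (f s w))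
    where
    comm : ∀ a b c → a * (b * c) ≡ b * (a * c)
    comm = solve-∀

∧-true⁻ : ∀ a {b} → a ∧ b ≡ true → b ≡ true
∧-true⁻ true p = p

module _ {A : Set} (sgn : A → Bool) where

  is : Bool → A → Bool
  is s x = if s then sgn x else not (sgn x)

  is⇒≡ : ∀ s x → is s x ≡ true → sgn x ≡ s
  is⇒≡ true  x p = p
  is⇒≡ false x p with sgn x
  ... | false = refl

  startsWith : Bool → List A → Bool
  -- An empty rest is compatible with both signs, so the last run of a word is no special case.
  startsWith s []      = true
  startsWith s (x ∷ _) = is s x

  ind-is : ∀ s x → ind (is (not s) x) + ind (is s x) ≡ + 1
  ind-is s x with s | sgn x
  ... | true  | true  = refl
  ... | true  | false = refl
  ... | false | true  = refl
  ... | false | false = refl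

  -- Exactly one prefix is the maximal first run. The cut marks its last letter, which makes the run
  -- nonempty by construction.
  first-run : ∀ s x w → ind (is s x) ≡ ∑C (x ∷ w) (λ v y w′ → ind (all (is s) (v ∷ʳ y)) * ind (startsWith (not s) w′))
  first-run s x [] = sym (trans (∑-[x] _ _) (trans (ℤ.*-identityʳ _) (cong ind (Bool.∧-identityʳ (is s x)))))
  first-run s x (y ∷ w) = sym (begin
    ∑C (x ∷ y ∷ w) h
      ≡⟨ ∑C-∷ x (y ∷ w) h ⟩
    ind (is s x ∧ true) * ind (is (not s) y) + ∑C (y ∷ w) (λ v → h (x ∷ v))
      ≡⟨ cong₂ _+_ (cong (_* ind (is (not s) y)) (trans (ind-∧ (is s x) true) (ℤ.*-identityʳ (ind (is s x)))))
           (∑C-cong (y ∷ w) λ v z w′ _ → trans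
             (cong (_* ind (startsWith (not s) w′)) (ind-∧ (is s x) (all (is s) (v ∷ʳ z))))
             (ℤ.*-assoc (ind (is s x)) _ _)) ⟩
    ind (is s x) * ind (is (not s) y) + ∑C (y ∷ w) (λ v z w′ → ind (is s x) * h v z w′)
      ≡⟨ cong (_+_ (ind (is s x) * ind (is (not s) y))) (trans (sym (∑-*ˡ (cuts (y ∷ w)) (ind (is s x)) _))
           (cong (ind (is s x) *_) (sym (first-run s y w)))) ⟩
    ind (is s x) * ind (is (not s) y) + ind (is s x) * ind (is s y)
      ≡⟨ ℤ.*-distribˡ-+ (ind (is s x)) _ _ ⟨
    ind (is s x) * (ind (is (not s) y) + ind (is s y))
      ≡⟨ cong (ind (is s x) *_) (ind-is s y) ⟩
    ind (is s x) * + 1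
      ≡⟨ ℤ.*-identityʳ (ind (is s x)) ⟩
    ind (is s x) ∎)
    where
    h : List A → A → List A → ℤ
    h v y w′ = ind (all (is s) (v ∷ʳ y)) * ind (startsWith (not s) w′)

  run-swap : ∀ s u {x y} v → sgn x ≢ sgn y → all (is s) (u ++ x ∷ y ∷ v) ≡ false
  run-swap s [] {x} {y} v n with is s x in p | is s y in q
  ... | true  | true  = contradiction (trans (is⇒≡ s x p) (sym (is⇒≡ s y q))) n
  ... | true  | false = refl
  ... | false | _     = refl
  run-swap s (z ∷ u) v n with is s z
  ... | true  = run-swap s u v n
  ... | false = refl

  -- Letters of different signs may be swapped too, since a word containing both is no run and the
  -- indicator kills both sides.
  run-sym : ∀ {χ} → Symmetric sgn χ → ∀ s → FullySymmetric (λ u → ind (all (is s) u) * χ u)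
  run-sym sχ s .swap u {x} {y} v _ with sgn x Bool.≟ sgn y
  ... | yes e = swap (restrict-sym sχ (is s)) u v e
  ... | no  n rewrite run-swap s u v n | run-swap s u v (λ e → n (sym e)) = refl
  run-sym sχ s .support u = support (restrict-sym sχ (is s)) u

  module _ (κ : Bool → Bool → ℤ) (up : A → A → Bool)
           (cross : ∀ a b → sgn b ≡ not (sgn a) → up a b ≡ sgn a) where

    -- At the end of a run the signs alone decide the comparison: the last letter gets the flag `s`,
    -- whatever the next letter is, and the next run starts with `not s`. The same holds at the end
    -- of the word by the choice of `sgn` as end flag.
    weight-run : ∀ s l v x w → all (is s) (v ∷ʳ x) ≡ true → startsWith (not s) w ≡ true →
                 weight κ up sgn l (v ++ x ∷ w) ≡ weight κ up (λ _ → s) l (v ∷ʳ x) * weight κ up sgn (not s) w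
    weight-run s l [] x []      p q with is s x in xs
    ... | true rewrite is⇒≡ s x xs = sym (ℤ.*-identityʳ _)
    weight-run s l [] x (b ∷ w) p q with is s x in xs
    ... | true rewrite trans (cross x b (trans (is⇒≡ (not s) b q) (cong not (sym (is⇒≡ s x xs))))) (is⇒≡ s x xs) = refl
    weight-run s l (a ∷ []) x w p q = trans (cong (κ l (up a x) *_) (weight-run s _ [] x w (∧-true⁻ (is s a) p) q)) (sym (ℤ.*-assoc (κ l (up a x)) _ _))
    weight-run s l (a ∷ b ∷ v) x w p q = trans (cong (κ l (up a b) *_) (weight-run s _ (b ∷ v) x w (∧-true⁻ (is s a) p) q)) (sym (ℤ.*-assoc (κ l (up a b)) _ _))

    module _ (as : List A) where
      open Words as

      first-run-sum : ∀ k s (χ : List A → ℤ) →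
        ∑W (suc k) (λ w → ind (startsWith s w) * χ w * weight κ up sgn s w) ≡
        ∑A k (λ i j → ∑W (suc i) λ u → ∑W j λ w →
          ind (all (is s) u) * weight κ up (λ _ → s) s u *
          (ind (startsWith (not s) w) * χ (u ++ w) * weight κ up sgn (not s) w))
      first-run-sum k s χ = begin
        ∑W (suc k) (λ w → ind (startsWith s w) * χ w * weight κ up sgn s w)
          ≡⟨ ∑W-cong as (suc k) (λ { (a ∷ u) _ → pointwise a u }) ⟩
        ∑W (suc k) (λ u → ∑C u (λ v x w → h (v ∷ʳ x) w))
          ≡⟨ ∑W-cuts k _ ⟩
        ∑A k (λ i j → ∑ as λ x → ∑W i λ v → ∑W j λ w → h (v ∷ʳ x) w)
          ≡⟨ ∑A-cong k (λ i j _ → sym (∑W-∷ʳ i (λ u → ∑W j λ w → h u w))) ⟩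
        ∑A k (λ i j → ∑W (suc i) λ u → ∑W j λ w → h u w) ∎
        where
        h : List A → List A → ℤ
        h u w = ind (all (is s) u) * weight κ up (λ _ → s) s u *
                (ind (startsWith (not s) w) * χ (u ++ w) * weight κ up sgn (not s) w)
        split : ∀ v x w → ind (all (is s) (v ∷ʳ x)) * ind (startsWith (not s) w) *
                          (χ (v ++ x ∷ w) * weight κ up sgn s (v ++ x ∷ w)) ≡ h (v ∷ʳ x) w
        split v x w rewrite ++-assoc v (x ∷ []) w
          with all (is s) (v ∷ʳ x) in p | startsWith (not s) w in q
        ... | true  | true  rewrite weight-run s s v x w p q = 
          rearrange (χ (v ++ x ∷ w)) (weight κ up (λ _ → s) s (v ∷ʳ x)) (weight κ up sgn (not s) w)
          where
          rearrange : ∀ c a b → + 1 * + 1 * (c * (a * b)) ≡ + 1 * a * (+ 1 * c * b)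
          rearrange = solve-∀
        ... | true  | false = zeros (χ (v ++ x ∷ w)) (weight κ up sgn s (v ++ x ∷ w)) (weight κ up (λ _ → s) s (v ∷ʳ x)) (weight κ up sgn (not s) w)
          where
          zeros : ∀ c d a b → + 1 * + 0 * (c * d) ≡ + 1 * a * (+ 0 * c * b)
          zeros = solve-∀
        ... | false | r     = zeros (ind r) (χ (v ++ x ∷ w)) (weight κ up sgn s (v ++ x ∷ w)) (weight κ up (λ _ → s) s (v ∷ʳ x)) (weight κ up sgn (not s) w)
          where
          zeros : ∀ r c d a b → + 0 * r * (c * d) ≡ + 0 * a * (r * c * b)
          zeros = solve-∀
        pointwise : ∀ a u → ind (is s a) * χ (a ∷ u) * weight κ up sgn s (a ∷ u) ≡ ∑C (a ∷ u) (λ v x w → h (v ∷ʳ x) w)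
        pointwise a u = begin
          ind (is s a) * χ (a ∷ u) * weight κ up sgn s (a ∷ u)
            ≡⟨ ℤ.*-assoc (ind (is s a)) _ _ ⟩
          ind (is s a) * (χ (a ∷ u) * weight κ up sgn s (a ∷ u))
            ≡⟨ cong (_* (χ (a ∷ u) * weight κ up sgn s (a ∷ u))) (first-run s a u) ⟩
          ∑C (a ∷ u) (λ v y w′ → ind (all (is s) (v ∷ʳ y)) * ind (startsWith (not s) w′)) * (χ (a ∷ u) * weight κ up sgn s (a ∷ u))
            ≡⟨ ∑-*ʳ (cuts (a ∷ u)) (χ (a ∷ u) * weight κ up sgn s (a ∷ u)) _ ⟩
          ∑C (a ∷ u) (λ v y w′ → ind (all (is s) (v ∷ʳ y)) * ind (startsWith (not s) w′) * (χ (a ∷ u) * weight κ up sgn s (a ∷ u)))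
            ≡⟨ ∑C-cong (a ∷ u) (λ v y w e → trans
                 (cong (λ z → ind (all (is s) (v ∷ʳ y)) * ind (startsWith (not s) w) * (χ z * weight κ up sgn s z)) (sym e))
                 (split v y w)) ⟩
          ∑C (a ∷ u) (λ v x w → h (v ∷ʳ x) w) ∎

  module _ (as : List A) {κ κ′ : Bool → Bool → ℤ} {up up′ : A → A → Bool}
           (ord : StrictTotal up) (ord′ : StrictTotal up′)
           (cross  : ∀ a b → sgn b ≡ not (sgn a) → up a b ≡ sgn a)
           (cross′ : ∀ a b → sgn b ≡ not (sgn a) → up′ a b ≡ sgn a)
           (κ-sym : ∀ l r → κ l r + κ r l ≡ κ′ l r + κ′ r l) where
    open Words as

    -- Strong induction on the length, bounded by `n`. For a fixed first run the rest is exchanged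
    -- by the induction hypothesis, with the run absorbed into χ as a prefix; then, for a fixed
    -- rest, the run is exchanged by `block-sum`.
    weight-transfer : ∀ n k → k ≤ n → ∀ s {χ} → Symmetric sgn χ →
      ∑W k (λ w → ind (startsWith s w) * χ w * weight κ  up  sgn s w) ≡
      ∑W k (λ w → ind (startsWith s w) * χ w * weight κ′ up′ sgn s w)
    weight-transfer n       zero    _         s {χ} sχ = trans (∑W-zero _) (sym (∑W-zero _))
    weight-transfer (suc n) (suc k) (s≤s k≤n) s {χ} sχ = begin
      ∑W (suc k) (λ w → ind (startsWith s w) * χ w * weight κ up sgn s w)
        ≡⟨ first-run-sum κ up cross as k s χ ⟩
      ∑A k (λ i j → ∑W (suc i) λ u → ∑W j λ w → R u * f u * (S w * χ (u ++ w) * F w))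
        ≡⟨ ∑A-cong k transfer ⟩
      ∑A k (λ i j → ∑W (suc i) λ u → ∑W j λ w → R u * f′ u * (S w * χ (u ++ w) * F′ w))
        ≡⟨ first-run-sum κ′ up′ cross′ as k s χ ⟨
      ∑W (suc k) (λ w → ind (startsWith s w) * χ w * weight κ′ up′ sgn s w) ∎
      where
      R S f f′ F F′ : List A → ℤ
      R u  = ind (all (is s) u)
      S w  = ind (startsWith (not s) w)
      f  u = weight κ  up  (λ _ → s) s u
      f′ u = weight κ′ up′ (λ _ → s) s u
      F  w = weight κ  up  sgn (not s) w
      F′ w = weight κ′ up′ sgn (not s) w

      turn : ∀ (f : List A → ℤ) i j → ∑W (suc i) (λ u → ∑W j λ w → R u * f u * (S w * χ (u ++ w) * F′ w)) ≡
                       ∑W j (λ w → S w * F′ w * ∑W (suc i) λ u → R u * χ (u ++ w) * f u)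
      turn f i j = trans (∑-swap (words (suc i)) (words j) _) (∑-cong (words j) λ w →
        trans (∑-cong (words (suc i)) λ u → rearrange (R u) (f u) (S w) (χ (u ++ w)) (F′ w))
              (sym (∑-*ˡ (words (suc i)) (S w * F′ w) _)))
        where
        rearrange : ∀ r f s c g → r * f * (s * c * g) ≡ s * g * (r * c * f)
        rearrange = solve-∀

      transfer : ∀ i j → i ℕ.+ j ≡ k → ∑W (suc i) (λ u → ∑W j λ w → R u * f u * (S w * χ (u ++ w) * F w)) ≡
                                       ∑W (suc i) (λ u → ∑W j λ w → R u * f′ u * (S w * χ (u ++ w) * F′ w))
      transfer i j e = begin
        ∑W (suc i) (λ u → ∑W j λ w → R u * f u * (S w * χ (u ++ w) * F w))
          ≡⟨ ∑-cong (words (suc i)) (λ u → trans (sym (∑-*ˡ (words j) (R u * f u) _))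
               (trans (cong (R u * f u *_) (weight-transfer n j (ℕ.≤-trans (subst (j ≤_) e (ℕ.m≤n+m j i)) k≤n) (not s) (prefix-sym sχ u)))
                 (∑-*ˡ (words j) (R u * f u) _))) ⟩
        ∑W (suc i) (λ u → ∑W j λ w → R u * f u * (S w * χ (u ++ w) * F′ w))
          ≡⟨ turn f i j ⟩
        ∑W j (λ w → S w * F′ w * ∑W (suc i) λ u → R u * χ (u ++ w) * f u)
          ≡⟨ ∑-cong (words j) (λ w → cong (S w * F′ w *_)
               (block-sum as (suc i) (weight-block κ ord s) (weight-block κ′ ord′ s)
                 (λ i j → κ-sym (flipIf s i) (flipIf s j)) (run-sym (suffix-sym sχ w) s))) ⟩
        ∑W j (λ w → S w * F′ w * ∑W (suc i) λ u → R u * χ (u ++ w) * f′ u)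
          ≡⟨ turn f′ i j ⟨
        ∑W (suc i) (λ u → ∑W j λ w → R u * f′ u * (S w * χ (u ++ w) * F′ w)) ∎

-- Uniqueness of the expansion, descents and peaks

∑-upTo-suc : ∀ n h → ∑ (upTo (suc n)) h ≡ h 0 + ∑ (upTo n) (λ i → h (suc i))
∑-upTo-suc n h = trans (∑-∷ 0 _ h) (cong (_+_ (h 0)) (trans (cong (λ l → ∑ l h) (sym (map-upTo suc n))) (∑-map suc (upTo n) h)))

∑-upTo-select : ∀ n k (h : ℕ → ℤ) → k < n → ∑ (upTo n) (λ i → ind (does (k ℕ.≟ i)) * h i) ≡ h k
∑-upTo-select (suc n) zero h _ = begin
  ∑ (upTo (suc n)) (λ i → ind (does (0 ℕ.≟ i)) * h i)   ≡⟨ ∑-upTo-suc n _ ⟩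
  + 1 * h 0 + ∑ (upTo n) (λ i → + 0 * h (suc i))        ≡⟨ cong (_+_ (+ 1 * h 0)) (trans (∑-cong (upTo n) λ i → ℤ.*-zeroˡ (h (suc i))) (∑-0 (upTo n))) ⟩
  + 1 * h 0 + + 0                                       ≡⟨ simp (h 0) ⟩
  h 0                                                   ∎
  where
  simp : ∀ x → + 1 * x + + 0 ≡ x
  simp = solve-∀
∑-upTo-select (suc n) (suc k) h (s≤s k<n) = begin
  ∑ (upTo (suc n)) (λ i → ind (does (suc k ℕ.≟ i)) * h i)              ≡⟨ ∑-upTo-suc n _ ⟩
  + 0 * h 0 + ∑ (upTo n) (λ i → ind (does (k ℕ.≟ i)) * h (suc i))      ≡⟨ cong₂ _+_ (ℤ.*-zeroˡ (h 0)) (∑-upTo-select n k (λ i → h (suc i)) k<n) ⟩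
  + 0 + h (suc k)                                                      ≡⟨ ℤ.+-identityˡ _ ⟩
  h (suc k)                                                            ∎

[1+t]^e : ∀ t e → ∃ λ q → (+ 1 + t) ^ e ≡ + 1 + t * q
[1+t]^e t zero    = + 0 , sym (cong (_+_ (+ 1)) (ℤ.*-zeroʳ t))
[1+t]^e t (suc e) with [1+t]^e t e
... | q , eq = + 1 + q + t * q , trans (cong ((+ 1 + t) *_) eq) (expand t q)
  where
  expand : ∀ t q → (+ 1 + t) * (+ 1 + t * q) ≡ + 1 + t * (+ 1 + q + t * q)
  expand = solve-∀

suc-abs-divides⇒0 : ∀ d z → d ≡ + suc ∣ d ∣ * z → d ≡ + 0
suc-abs-divides⇒0 d z e with ∣ z ∣ | trans (cong ∣_∣ e) (ℤ.∣i*j∣≡∣i∣*∣j∣ (+ suc ∣ d ∣) z)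
... | zero  | q = ℤ.∣i∣≡0⇒i≡0 (trans q (ℕ.*-zeroʳ (suc ∣ d ∣)))
... | suc m | q = contradiction q (ℕ.<⇒≢ (ℕ.m≤m*n (suc ∣ d ∣) (suc m)))

-- Modulo t the constant coefficient is the whole sum; as t is arbitrary, it is determined.
expansion-unique : ∀ n (e : ℕ → ℕ) (a b : ℕ → ℤ) →
  (∀ k → ∑ (upTo n) (λ i → a i * (+ suc k) ^ i * (+ 1 + + suc k) ^ e i) ≡
         ∑ (upTo n) (λ i → b i * (+ suc k) ^ i * (+ 1 + + suc k) ^ e i)) →
  ∀ i → i < n → a i ≡ b i
expansion-unique (suc n) e a b H = λ where
    zero    _         → a0≡b0
    (suc i) (s≤s i<n) → expansion-unique n (λ i → e (suc i)) (λ i → a (suc i)) (λ i → b (suc i)) tails i i<n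
  where
  tail : (ℕ → ℤ) → ℤ → ℤ
  tail a t = ∑ (upTo n) (λ i → a (suc i) * t ^ i * (+ 1 + t) ^ e (suc i))

  split : ∀ a t → ∑ (upTo (suc n)) (λ i → a i * t ^ i * (+ 1 + t) ^ e i) ≡ a 0 * (+ 1 + t) ^ e 0 + t * tail a t
  split a t = trans (∑-upTo-suc n _) (cong₂ _+_ (cong (_* (+ 1 + t) ^ e 0) (ℤ.*-identityʳ (a 0)))
    (trans (∑-cong (upTo n) λ i → pull (a (suc i)) t (t ^ i) ((+ 1 + t) ^ e (suc i))) (sym (∑-*ˡ (upTo n) t _))))
    where
    pull : ∀ a t u v → a * (t * u) * v ≡ t * (a * u * v)
    pull = solve-∀

  H′ : ∀ k → let t = + suc k in a 0 * (+ 1 + t) ^ e 0 + t * tail a t ≡ b 0 * (+ 1 + t) ^ e 0 + t * tail b t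
  H′ k = trans (sym (split a (+ suc k))) (trans (H k) (split b (+ suc k)))

  divides : ∀ a₀ b₀ q t A B → a₀ * (+ 1 + t * q) + t * A ≡ b₀ * (+ 1 + t * q) + t * B →
            a₀ - b₀ ≡ t * (B - A - (a₀ - b₀) * q)
  divides a₀ b₀ q t A B h = begin
    a₀ - b₀                                                                    ≡⟨ id₁ a₀ b₀ q t A B ⟩
    (a₀ * (+ 1 + t * q) + t * A) - b₀ - a₀ * (t * q) - t * A                   ≡⟨ cong (λ z → z - b₀ - a₀ * (t * q) - t * A) h ⟩
    (b₀ * (+ 1 + t * q) + t * B) - b₀ - a₀ * (t * q) - t * A                   ≡⟨ id₂ a₀ b₀ q t A B ⟩
    t * (B - A - (a₀ - b₀) * q)                                                ∎
    where
    id₁ : ∀ a₀ b₀ q t A B → a₀ - b₀ ≡ (a₀ * (+ 1 + t * q) + t * A) - b₀ - a₀ * (t * q) - t * A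
    id₁ = solve-∀
    id₂ : ∀ a₀ b₀ q t A B → (b₀ * (+ 1 + t * q) + t * B) - b₀ - a₀ * (t * q) - t * A ≡ t * (B - A - (a₀ - b₀) * q)
    id₂ = solve-∀

  a0≡b0 : a 0 ≡ b 0
  -- The evaluation point is one more than the absolute value of `a 0 - b 0`; it divides that
  -- difference, which must then be zero.
  a0≡b0 with [1+t]^e (+ suc ∣ a 0 - b 0 ∣) (e 0) | H′ ∣ a 0 - b 0 ∣
  ... | q , eq | h rewrite eq = ℤ.i-j≡0⇒i≡j _ _ (suc-abs-divides⇒0 (a 0 - b 0) _
        (divides (a 0) (b 0) q (+ suc ∣ a 0 - b 0 ∣) (tail a (+ suc ∣ a 0 - b 0 ∣)) (tail b (+ suc ∣ a 0 - b 0 ∣)) h))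

  tails : ∀ k → tail a (+ suc k) ≡ tail b (+ suc k)
  tails k = ℤ.*-cancelˡ-≡ (+ suc k) _ _
    (∙-cancelˡ ℤ.+-0-abelianGroup (a 0 * (+ 1 + + suc k) ^ e 0) _ _ (trans (H′ k) (cong (λ z → z * (+ 1 + + suc k) ^ e 0 + + suc k * tail b (+ suc k)) (sym a0≡b0))))

-- The weights that count descents and peaks

κ-des κ-peak : ℤ → Bool → Bool → ℤ
κ-des t true  _ = + 2 * t
κ-des t false _ = + 2

κ-peak t true  true  = + 2 * t
κ-peak t false false = + 2
κ-peak t _     _     = + 1 + t

κ-sym : ∀ t l r → κ-des t l r + κ-des t r l ≡ κ-peak t l r + κ-peak t r l
κ-sym t true  true  = refl
κ-sym t false false = refl
κ-sym t true  false = lemma t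
  where
  lemma : ∀ t → + 2 * t + + 2 ≡ (+ 1 + t) + (+ 1 + t)
  lemma = solve-∀
κ-sym t false true  = lemma t
  where
  lemma : ∀ t → + 2 + + 2 * t ≡ (+ 1 + t) + (+ 1 + t)
  lemma = solve-∀

module _ {A : Set} (ω : A → ℤ) (inj : Injective _≡_ _≡_ ω) where

  below : A → A → Bool
  below a b = does (ω a <? ω b)

  below-true : ∀ a b → below a b ≡ true → ω a ℤ.< ω b
  below-true a b p with ω a <? ω b
  ... | yes q = q

  below-false : ∀ a b → a ≢ b → below a b ≡ false → ω b ℤ.< ω a
  below-false a b n p with ℤ.<-cmp (ω a) (ω b)
  ... | tri< q _ _ with () ← trans (sym p) (dec-true (ω a <? ω b) q)
  ... | tri≈ _ q _ = contradiction (inj q) n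
  ... | tri> _ _ q = q

  below-total : StrictTotal below
  below-total = record
    { asym  = λ x y p → dec-false (ω y <? ω x) (λ q → ℤ.<-asym q (below-true x y p))
    ; trns  = λ x y z p q → dec-true (ω x <? ω z) (ℤ.<-trans (below-true x y p) (below-true y z q))
    ; total = λ x y n p → dec-true (ω y <? ω x) (below-false x y n p)
    }

  -- A letter after the first has a larger left neighbour exactly when it ends a descent, so it
  -- contributes 2t there and 2 elsewhere.
  weight-des : ∀ t end l a w → AllPairs _≢_ (a ∷ w) →
    weight (κ-des t) below end l (a ∷ w) ≡ κ-des t l true * ((+ 2) ^ length w * t ^ des (map ω (a ∷ w)))
  weight-des t end l a [] _ = lemma l
    where
    lemma : ∀ l → κ-des t l (end a) ≡ κ-des t l true * (+ 1 * + 1)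
    lemma true  = sym (ℤ.*-identityʳ _)
    lemma false = refl
  weight-des t end l a (b ∷ w) ((a≢b ∷ _) ∷ d) = cong₂ _*_ (lemma l) step
    where
    lemma : ∀ l → κ-des t l (below a b) ≡ κ-des t l true
    lemma true  = refl
    lemma false = refl
    p = (+ 2) ^ length w
    q = t ^ des (map ω (b ∷ w))
    step : weight (κ-des t) below end (not (below a b)) (b ∷ w) ≡ + 2 * p * t ^ des (map ω (a ∷ b ∷ w))
    step with weight-des t end (not (below a b)) b w d
    ... | ih with below a b in up | ω b <? ω a
    ... | true  | yes r = contradiction (below-true a b up) (ℤ.<-asym r)
    ... | true  | no  _ = trans ih (assoc p q)
      where
      assoc : ∀ p q → + 2 * (p * q) ≡ + 2 * p * q
      assoc = solve-∀
    ... | false | yes _ = trans ih (assoc t p q)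
      where
      assoc : ∀ t p q → + 2 * t * (p * q) ≡ + 2 * p * (t * q)
      assoc = solve-∀
    ... | false | no  r = contradiction (below-false a b a≢b up) r

  peak-descent : ∀ a b w → below a b ≡ false → peak (map ω (a ∷ b ∷ w)) ≡ peak (map ω (b ∷ w))
  peak-descent a b []      p = refl
  peak-descent a b (c ∷ w) p with ω a <? ω b
  ... | no _ = refl

  peak-ascent : ∀ z a b w → below a b ≡ true → peak (map ω (z ∷ a ∷ b ∷ w)) ≡ peak (map ω (a ∷ b ∷ w))
  peak-ascent z a b w p with ω z <? ω a | ω b <? ω a
  ... | no  _ | _     = refl
  ... | yes _ | no _  = refl
  ... | yes _ | yes r = contradiction (below-true a b p) (ℤ.<-asym r)

  peak-summit : ∀ z a b w → a ≢ b → below z a ≡ true → below a b ≡ false →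
                peak (map ω (z ∷ a ∷ b ∷ w)) ≡ suc (peak (map ω (b ∷ w)))
  peak-summit z a b w n p q with peak-descent a b w q
  ... | e with ω z <? ω a | ω b <? ω a
  ... | yes _ | yes _ = cong suc e
  ... | yes _ | no  r = contradiction (below-false a b n q) r

  EndsIn : (A → Bool) → List A → Set
  EndsIn end w = ∀ v x → w ≡ v ∷ʳ x → end x ≡ true

  module _ (t : ℤ) (end : A → Bool) where

    -- Two states of one scan. After a step down, one valley more than peaks is still to come, since
    -- the word also ends on a valley side: hence the single 2t. After a step up from `z` they are
    -- equal in number, and each peak with its next valley gives 4t; `z` is kept because it decides
    -- whether `a` is a peak. The exponent `e` counts the remaining letters, each worth 1 + t.
    weight-valley : ∀ a w → AllPairs _≢_ (a ∷ w) → EndsIn end (a ∷ w) → ∃ λ e →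
      weight (κ-peak t) below end true (a ∷ w) ≡ + 2 * t * ((+ 4 * t) ^ peak (map ω (a ∷ w)) * (+ 1 + t) ^ e) ×
      peak (map ω (a ∷ w)) ℕ.+ peak (map ω (a ∷ w)) ℕ.+ e ≡ length w
    weight-slope : ∀ z a w → below z a ≡ true → AllPairs _≢_ (a ∷ w) → EndsIn end (a ∷ w) → ∃ λ e →
      weight (κ-peak t) below end false (a ∷ w) ≡ (+ 4 * t) ^ peak (map ω (z ∷ a ∷ w)) * (+ 1 + t) ^ e ×
      peak (map ω (z ∷ a ∷ w)) ℕ.+ peak (map ω (z ∷ a ∷ w)) ℕ.+ e ≡ suc (length w)

    weight-valley a [] d en rewrite en [] a refl = 0 , sym (ℤ.*-identityʳ _) , refl
    weight-valley a (b ∷ w) ((a≢b ∷ _) ∷ d) en with below a b in up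
    ... | true with weight-slope a b w up d (λ v x q → en (a ∷ v) x (cong (a ∷_) q))
    ...   | e , eq , len = e , cong (+ 2 * t *_) eq , len
    weight-valley a (b ∷ w) ((a≢b ∷ _) ∷ d) en | false
      with weight-valley b w d (λ v x q → en (a ∷ v) x (cong (a ∷_) q))
    ... | e , eq , len rewrite peak-descent a b w up =
      suc e , trans (cong ((+ 1 + t) *_) eq) (move (+ 1 + t) (+ 2 * t) ((+ 4 * t) ^ peak (map ω (b ∷ w))) ((+ 1 + t) ^ e)) ,
      trans (ℕ.+-suc _ e) (cong suc len)
      where
      move : ∀ s u v w → s * (u * (v * w)) ≡ u * (v * (s * w))
      move = solve-∀

    weight-slope z a [] up d en rewrite en [] a refl = 1 , lemma t , refl
      where
      lemma : ∀ t → + 1 + t ≡ + 1 * ((+ 1 + t) * + 1)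
      lemma = solve-∀
    weight-slope z a (b ∷ w) za ((a≢b ∷ _) ∷ d) en with below a b in up
    ... | true with weight-slope a b w up d (λ v x q → en (a ∷ v) x (cong (a ∷_) q))
    ...   | e , eq , len rewrite peak-ascent z a b w up =
      suc e , trans (cong ((+ 1 + t) *_) eq) (move (+ 1 + t) ((+ 4 * t) ^ peak (map ω (a ∷ b ∷ w))) ((+ 1 + t) ^ e)) , trans (ℕ.+-suc _ e) (cong suc len)
      where
      move : ∀ s v w → s * (v * w) ≡ v * (s * w)
      move = solve-∀
    weight-slope z a (b ∷ w) za ((a≢b ∷ _) ∷ d) en | false
      with weight-valley b w d (λ v x q → en (a ∷ v) x (cong (a ∷_) q))
    ... | e , eq , len rewrite peak-summit z a b w a≢b za up =
      e , trans (cong (+ 2 *_) eq) (move t ((+ 4 * t) ^ k) ((+ 1 + t) ^ e)) ,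
      trans (cong (λ n → suc n ℕ.+ e) (ℕ.+-suc k k)) (cong (λ n → suc (suc n)) len)
      where
      k = peak (map ω (b ∷ w))
      move : ∀ t u v → + 2 * (+ 2 * t * (u * v)) ≡ + 4 * t * u * v
      move = solve-∀

-- Signs and linear extensions

module _ {p : ℕ} (P : FinPoset p) where
  private
    module P = FinPoset P
    module ≤P = IsPartialOrder P.isPartialOrder

  -- Climb from `x` through elements below `y` until none is left in between; this stops because the
  -- order is noetherian.
  cover-below : ∀ {x y} → x P.<P y → ∃ λ z → (z P.⋖ y) × (x P.≤P z)
  cover-below {x} = go x (po-noetherian P.isPartialOrder x)
    where
    go : ∀ x → Acc (flip P._<P_) x → ∀ {y} → x P.<P y → ∃ λ z → (z P.⋖ y) × (x P.≤P z)
    go x (acc rs) {y} x<y with Fin.any? (λ z → (x P.<P? z) ×-dec (z P.<P? y))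
    ... | no  none              = x , (x<y , λ z q → none (z , q)) , ≤P.refl
    ... | yes (z , x<z , z<y) with go z (rs x<z) z<y
    ...   | w , w⋖y , z≤w = w , w⋖y , ≤P.trans (proj₁ x<z) z≤w

  cover-induction : (Q : Fin p → Set) → (∀ x → P.Minimal x → Q x) → (∀ x y → x P.⋖ y → Q x → Q y) → ∀ y → Q y
  cover-induction Q base step y = go y (po-wellFounded P.isPartialOrder y)
    where
    go : ∀ y → Acc P._<P_ y → Q y
    go y (acc rs) with Fin.any? (λ z → z P.<P? y)
    ... | no  none      = base y (λ z q → none (z , q))
    ... | yes (z , z<y) with cover-below z<y
    ...   | w , w⋖y , _ = step w y w⋖y (go w (rs (proj₁ w⋖y)))

  _∷ʳᶜ_ : ∀ {x y z} → P.Chain x y → y P.⋖ z → P.Chain x z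
  [ x ]   ∷ʳᶜ e = e ∷ [ _ ]
  (d ∷ c) ∷ʳᶜ e = d ∷ (c ∷ʳᶜ e)

  chain-from-minimal : ∀ y → ∃ λ x → P.Minimal x × P.Chain x y
  chain-from-minimal = cover-induction _ (λ x m → x , m , [ x ]) (λ { x y e (z , m , c) → z , m , c ∷ʳᶜ e })

  -- By `cover-induction` these two rules determine `sgn` completely, which is why the labels of `P`
  -- and of `P̂` agree in sign on `P`.
  record Alternating (sgn : Fin p → Bool) : Set where
    field
      minimal : ∀ x → P.Minimal x → sgn x ≡ true
      cover   : ∀ x y → x P.⋖ y → sgn y ≡ not (sgn x)

  module _ (ω : Fin p → ℤ) where

    εsum-∷ʳᶜ : ∀ {x y z} (c : P.Chain x y) (e : y P.⋖ z) → εsum P ω (c ∷ʳᶜ e) ≡ εsum P ω c + ε P ω y z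
    εsum-∷ʳᶜ {z = z} [ x ] e = trans (ℤ.+-identityʳ (ε P ω x z)) (sym (ℤ.+-identityˡ (ε P ω x z)))
    εsum-∷ʳᶜ {z = z} (_∷_ {x} {y} d c) e = trans (cong (_+_ (ε P ω x y)) (εsum-∷ʳᶜ c e)) (sym (ℤ.+-assoc (ε P ω x y) (εsum P ω c) _))

    ε-nonzero : ∀ x y → ε P ω x y ≢ + 0
    ε-nonzero x y e with ω x <? ω y
    ε-nonzero x y () | yes _
    ε-nonzero x y () | no _

    negative : Fin p → Bool
    negative x = does (ω x <? + 0)

    cross-below : ∀ a b → negative b ≡ not (negative a) → does (ω a <? ω b) ≡ negative a
    cross-below a b e with ω a <? + 0 | ω b <? + 0
    ... | yes a<0 | no  b≮0 = dec-true  (ω a <? ω b) (ℤ.<-≤-trans a<0 (ℤ.≮⇒≥ b≮0))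
    ... | no  a≮0 | yes b<0 = dec-false (ω a <? ω b) (λ a<b → a≮0 (ℤ.<-trans a<b b<0))

    -- Extending a chain by one cover changes its ε-sum by a nonzero amount; as both sums lie in {0,
    -- 1}, they differ, and so do the signs of the labels.
    canonical⇒alternating : Canonical P ω → Alternating negative
    canonical⇒alternating (_ , can) = record { minimal = minimal ; cover = cover }
      where
      minimal : ∀ x → P.Minimal x → negative x ≡ true
      minimal x m with can x x [ x ] m
      ... | inj₁ (_ , neg) = dec-true (ω x <? + 0) neg
      cover : ∀ x y → x P.⋖ y → negative y ≡ not (negative x)
      cover x y e with chain-from-minimal x
      ... | z , m , c with can z x c m | can z y (c ∷ʳᶜ e) m | εsum-∷ʳᶜ c e
      ... | inj₁ (c0 , _) | inj₁ (c0′ , _) | s =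
        contradiction (trans (sym (ℤ.+-identityˡ _)) (trans (cong (_+ ε P ω x y) (sym c0)) (trans (sym s) c0′))) (ε-nonzero x y)
      ... | inj₁ (_ , x<0) | inj₂ (_ , 0<y) | _ = trans (dec-false (ω y <? + 0) (ℤ.<-asym 0<y)) (cong not (sym (dec-true (ω x <? + 0) x<0)))
      ... | inj₂ (_ , 0<x) | inj₁ (_ , y<0) | _ = trans (dec-true (ω y <? + 0) y<0) (cong not (sym (dec-false (ω x <? + 0) (ℤ.<-asym 0<x))))
      ... | inj₂ (c1 , _) | inj₂ (c1′ , _) | s =
        contradiction (∙-cancelˡ ℤ.+-0-abelianGroup (+ 1) (ε P ω x y) (+ 0) (trans (cong (_+ ε P ω x y) (sym c1)) (trans (sym s) c1′))) (ε-nonzero x y)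

    maximal-rank0 : Canonical P ω → SignGraded P ω (+ 0) → ∀ y → P.Maximal y → negative y ≡ true
    maximal-rank0 (_ , can) graded y max with chain-from-minimal y
    ... | x , m , c with can x y c m
    ... | inj₁ (_ , y<0) = dec-true (ω y <? + 0) y<0
    ... | inj₂ (c1 , _) with () ← trans (sym (graded x y c m max)) c1

    maximal-rank1 : Canonical P ω → SignGraded P ω (+ 1) → ∀ y → P.Maximal y → negative y ≡ false
    maximal-rank1 (_ , can) graded y max with chain-from-minimal y
    ... | x , m , c with can x y c m
    ... | inj₂ (_ , 0<y) = dec-false (ω y <? + 0) (ℤ.<-asym 0<y)
    ... | inj₁ (c0 , _) with () ← trans (sym (graded x y c m max)) c0

  -- A lower cover of `y` above `x` has the sign opposite to that of `y`, hence is not `x` itself.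
  between : ∀ {sgn} → Alternating sgn → ∀ {x y} → x P.<P y → sgn x ≡ sgn y → ∃ λ z → x P.<P z × z P.<P y
  between {sgn} alt {x} {y} x<y same with cover-below x<y
  ... | z , z⋖y , x≤z = z , (x≤z , λ { refl → b≢not-b (sgn y) (trans (Alternating.cover alt x y z⋖y) (cong not same)) }) , proj₁ z⋖y
    where
    b≢not-b : ∀ b → b ≢ not b
    b≢not-b true  ()
    b≢not-b false ()

  CanPrecede : Fin p → Fin p → Set
  CanPrecede x y = x ≢ y × ¬ (y P.<P x)

  -- A pairwise form without positions, which is easy to follow through cuts and swaps of words.
  LinExt : List (Fin p) → Set
  LinExt w = AllPairs CanPrecede w × (∀ z → z ∈ w)

  opaque
    linExt? : ∀ w → Dec (LinExt w)
    linExt? w = allPairs? (λ x y → ¬? (x Fin.≟ y) ×-dec ¬? (y P.<P? x)) w ×-dec Fin.all? (λ z → DecMembership._∈?_ Fin._≟_ z w)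

  χ : List (Fin p) → ℤ
  χ w = ind (does (linExt? w))

  χ-cases : ∀ w → χ w ≡ + 0 ⊎ LinExt w
  χ-cases w = cases (linExt? w)
    where
    cases : ∀ {A : Set} (d : Dec A) → ind (does d) ≡ + 0 ⊎ A
    cases (yes a) = inj₂ a
    cases (no  _) = inj₁ refl

AllPairs-cross : {A : Set} {R : A → A → Set} (u : List A) {v : List A} → AllPairs R (u ++ v) →
                 ∀ {x y} → x ∈ u → y ∈ v → R x y
AllPairs-cross (a ∷ u) (r ∷ _)  (here refl) j = All.lookup r (∈-++⁺ʳ u j)
AllPairs-cross (a ∷ u) (_ ∷ rs) (there i)   j = AllPairs-cross u rs i j

AllPairs-swap : {A : Set} {R : A → A → Set} (u : List A) {x y : A} {v : List A} →
                R y x → AllPairs R (u ++ x ∷ y ∷ v) → AllPairs R (u ++ y ∷ x ∷ v)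
AllPairs-swap []      r ((_ ∷ rx) ∷ ry ∷ rs) = (r ∷ ry) ∷ rx ∷ rs
AllPairs-swap {R = R} (a ∷ u) {x} {y} {v} r (ra ∷ rs) = All.++⁺ (All.++⁻ˡ u ra) (swapped (All.++⁻ʳ u ra)) ∷ AllPairs-swap u r rs
  where
  swapped : All (R a) (x ∷ y ∷ v) → All (R a) (y ∷ x ∷ v)
  swapped (p ∷ q ∷ ps) = q ∷ p ∷ ps

∈-swap : {A : Set} (u : List A) {x y : A} {v : List A} {z : A} → z ∈ u ++ x ∷ y ∷ v → z ∈ u ++ y ∷ x ∷ v
∈-swap []      (here e)          = there (here e)
∈-swap []      (there (here e))  = here e
∈-swap []      (there (there i)) = there (there i)
∈-swap (a ∷ u) (here e)          = here e
∈-swap (a ∷ u) (there i)         = there (∈-swap u i)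

first-minimal : ∀ {p} (P : FinPoset p) x w → LinExt P (x ∷ w) → Minimal P x
first-minimal P x w (r ∷ _ , complete) y y<x with complete y
... | here refl = proj₂ y<x refl
... | there i   = proj₂ (All.lookup r i) y<x

module _ {p : ℕ} (P : FinPoset p) {sgn : Fin p → Bool} (alt : Alternating P sgn) where
  private
    module P = FinPoset P

  -- An element strictly between x and y would have to occur between them in the word.
  LinExt-swap : ∀ u {x y} v → sgn x ≡ sgn y → LinExt P (u ++ x ∷ y ∷ v) → LinExt P (u ++ y ∷ x ∷ v)
  LinExt-swap u {x} {y} v same (pairs , complete) = AllPairs-swap u (y≢x , x≮y) pairs , λ z → ∈-swap u (complete z)
    where
    y≢x : y ≢ x
    y≢x refl = proj₁ (All.head (AllPairs.head (AllPairs-++ʳ u pairs))) refl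
    x≮y : ¬ (x P.<P y)
    x≮y x<y with between P alt x<y same
    ... | z , x<z , z<y with ∈-++⁻ u (complete z)
    ... | inj₁ z∈u                       = proj₂ (AllPairs-cross u pairs z∈u (here refl)) x<z
    ... | inj₂ (here refl)               = proj₂ x<z refl
    ... | inj₂ (there (here refl))       = proj₂ z<y refl
    ... | inj₂ (there (there z∈v))       = proj₂ (All.lookup (AllPairs.head (AllPairs.tail (AllPairs-++ʳ u pairs))) z∈v) z<y

  χ-symmetric : Symmetric sgn (χ P)
  χ-symmetric = record
    { swap    = λ u v same → cong ind (does-⇔ (mk⇔ (LinExt-swap u v same) (LinExt-swap u v (sym same))) (linExt? P _) (linExt? P _))
    ; support = λ u → distinct u (χ-cases P u)
    }
    where
    distinct : ∀ u → χ P u ≡ + 0 ⊎ LinExt P u → χ P u ≡ + 0 ⊎ AllPairs _≢_ u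
    distinct u (inj₁ z)       = inj₁ z
    distinct u (inj₂ (d , _)) = inj₂ (AllPairs.map proj₁ d)

  -- A linear extension begins with a minimal element, which is negative; so the condition on the
  -- first sign in `weight-transfer` can be added and dropped freely.
  first-negative : ∀ w → ind (startsWith sgn true w) * χ P w ≡ χ P w
  first-negative []      = ℤ.*-identityˡ (χ P [])
  first-negative (a ∷ w) with χ-cases P (a ∷ w)
  ... | inj₁ z rewrite z = ℤ.*-zeroʳ (ind (sgn a))
  ... | inj₂ l rewrite Alternating.minimal alt a (first-minimal P a w l) = ℤ.*-identityˡ (χ P (a ∷ w))

last-maximal : ∀ {p} (P : FinPoset p) v x → LinExt P (v ∷ʳ x) → Maximal P x
last-maximal P v x (pairs , complete) y x<y with ∈-++⁻ v (complete y)
... | inj₁ i           = proj₂ (AllPairs-cross v pairs i (here refl)) x<y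
... | inj₂ (here refl) = proj₂ x<y refl

-- Jordan-Hölder words as words over the ground set

module _ {A : Set} {R : A → A → Set} where

  All-toList : ∀ {Q : A → Set} {n} (π : Vec A n) → (∀ i → Q (lookup π i)) → All Q (toList π)
  All-toList Vec.[]      q = []
  All-toList (x Vec.∷ π) q = q zero ∷ All-toList π (λ i → q (suc i))

  All-lookup : ∀ {Q : A → Set} {n} (π : Vec A n) → All Q (toList π) → ∀ i → Q (lookup π i)
  All-lookup (x Vec.∷ π) (q ∷ _)  zero    = q
  All-lookup (x Vec.∷ π) (_ ∷ qs) (suc i) = All-lookup π qs i

  AllPairs-toList : ∀ {n} (π : Vec A n) → (∀ i j → i Fin.< j → R (lookup π i) (lookup π j)) → AllPairs R (toList π)
  AllPairs-toList Vec.[]      r = []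
  AllPairs-toList (x Vec.∷ π) r = All-toList π (λ j → r zero (suc j) (s≤s z≤n)) ∷ AllPairs-toList π (λ i j i<j → r (suc i) (suc j) (s≤s i<j))

  AllPairs-lookup : ∀ {n} (π : Vec A n) → AllPairs R (toList π) → ∀ i j → i Fin.< j → R (lookup π i) (lookup π j)
  AllPairs-lookup (x Vec.∷ π) (r ∷ _)  zero    (suc j) _         = All-lookup π r j
  AllPairs-lookup (x Vec.∷ π) (_ ∷ rs) (suc i) (suc j) (s≤s i<j) = AllPairs-lookup π rs i j i<j

lookup-∈ : {A : Set} {n : ℕ} (π : Vec A n) (i : Fin n) → lookup π i ∈ toList π
lookup-∈ (x Vec.∷ π) zero    = here refl
lookup-∈ (x Vec.∷ π) (suc i) = there (lookup-∈ π i)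

injective⇒surjective : ∀ {n} (f : Fin n → Fin n) → Injective _≡_ _≡_ f → ∀ z → ∃ λ i → f i ≡ z
injective⇒surjective {suc n} f inj z with Fin.any? (λ i → f i Fin.≟ z)
... | yes hit  = hit
-- Punching out a missed value would embed `Fin (suc n)` into `Fin n`.
... | no  miss = contradiction (Fin.injective⇒≤ {f = λ i → Fin.punchOut (z≢ i)} (λ {i} {j} e → inj (Fin.punchOut-injective (z≢ i) (z≢ j) e))) ℕ.1+n≰n
  where
  z≢ : ∀ i → z ≢ f i
  z≢ i e = miss (i , sym e)

module _ {p : ℕ} (P : FinPoset p) where
  private
    module P = FinPoset P

  IsLinExt⇒LinExt : ∀ π → IsLinExt P π → LinExt P (toList π)
  IsLinExt⇒LinExt π (inj , ord) =
    AllPairs-toList π (λ i j i<j → (λ e → Fin.<⇒≢ i<j (inj i j e)) , λ q → Fin.<-asym i<j (ord j i q)) , complete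
    where
    complete : ∀ z → z ∈ toList π
    complete z with injective⇒surjective (lookup π) (λ {i} {j} → inj i j) z
    ... | i , refl = lookup-∈ π i

  LinExt⇒IsLinExt : ∀ π → LinExt P (toList π) → IsLinExt P π
  LinExt⇒IsLinExt π (pairs , _) = inj , monotone
    where
    inj : ∀ i j → lookup π i ≡ lookup π j → i ≡ j
    inj i j e with Fin.<-cmp i j
    ... | tri< i<j _ _ = contradiction e (proj₁ (AllPairs-lookup π pairs i j i<j))
    ... | tri≈ _ q _   = q
    ... | tri> _ _ j<i = contradiction (sym e) (proj₁ (AllPairs-lookup π pairs j i j<i))
    monotone : ∀ i j → lookup π i P.<P lookup π j → i Fin.< j
    monotone i j q with Fin.<-cmp i j
    ... | tri< i<j _ _  = i<j
    ... | tri≈ _ refl _ = contradiction refl (proj₂ q)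
    ... | tri> _ _ j<i  = contradiction q (proj₂ (AllPairs-lookup π pairs j i j<i))

∑-filter : {B : Set} {Q : B → Set} (Q? : ∀ x → Dec (Q x)) (xs : List B) (g : B → ℤ) →
           ∑ (filter Q? xs) g ≡ ∑ xs (λ x → ind (does (Q? x)) * g x)
∑-filter Q? []       g = trans (∑-[] _) (sym (∑-[] _))
∑-filter Q? (x ∷ xs) g with Q? x in eq
... | yes _ = begin
  ∑ (x ∷ filter Q? xs) g                                     ≡⟨ ∑-∷ x _ g ⟩
  g x + ∑ (filter Q? xs) g                                   ≡⟨ cong₂ _+_ (sym (ℤ.*-identityˡ (g x))) (∑-filter Q? xs g) ⟩
  + 1 * g x + ∑ xs (λ x → ind (does (Q? x)) * g x)           ≡⟨ cong (λ d → ind (does d) * g x + ∑ xs (λ x → ind (does (Q? x)) * g x)) eq ⟨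
  _                                                          ≡⟨ ∑-∷ x xs _ ⟨
  ∑ (x ∷ xs) (λ x → ind (does (Q? x)) * g x)                 ∎
... | no  _ = begin
  ∑ (filter Q? xs) g                                         ≡⟨ ∑-filter Q? xs g ⟩
  ∑ xs (λ x → ind (does (Q? x)) * g x)                       ≡⟨ ℤ.+-identityˡ _ ⟨
  + 0 + ∑ xs (λ x → ind (does (Q? x)) * g x)                 ≡⟨ cong (_+ ∑ xs (λ x → ind (does (Q? x)) * g x)) (ℤ.*-zeroˡ (g x)) ⟨
  + 0 * g x + ∑ xs (λ x → ind (does (Q? x)) * g x)           ≡⟨ cong (λ d → ind (does d) * g x + ∑ xs (λ x → ind (does (Q? x)) * g x)) eq ⟨
  _                                                          ≡⟨ ∑-∷ x xs _ ⟨
  ∑ (x ∷ xs) (λ x → ind (does (Q? x)) * g x)                 ∎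

length-∑ : {B : Set} (xs : List B) → + length xs ≡ ∑ xs (λ _ → + 1)
length-∑ []       = sym (∑-[] _)
length-∑ (x ∷ xs) = trans (cong (_+_ (+ 1)) (length-∑ xs)) (sym (∑-∷ x xs _))

∑-allWords : ∀ n k (h : List (Fin n) → ℤ) → ∑ (allWords n k) (h ∘ toList) ≡ Words.∑W (allFin n) k h
∑-allWords n zero    h = trans (∑-[x] _ _) (sym (∑-[x] _ _))
∑-allWords n (suc k) h = begin
  ∑ (allWords n (suc k)) (h ∘ toList)
    ≡⟨ ∑-concatMap _ (allFin n) _ ⟩
  ∑ (allFin n) (λ x → ∑ (map (x Vec.∷_) (allWords n k)) (h ∘ toList))
    ≡⟨ ∑-cong (allFin n) (λ x → trans (∑-map _ (allWords n k) _) (∑-allWords n k (h ∘ (x ∷_)))) ⟩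
  ∑ (allFin n) (λ x → Words.∑W (allFin n) k (h ∘ (x ∷_)))
    ≡⟨ Words.∑W-suc (allFin n) k h ⟨
  Words.∑W (allFin n) (suc k) h ∎

∑-JH : ∀ {p} (P : FinPoset p) (ω : Fin p → ℤ) (g : List ℤ → ℤ) →
       ∑ (JH P ω) g ≡ Words.∑W (allFin p) p (λ w → χ P w * g (map ω w))
∑-JH {p} P ω g = begin
  ∑ (JH P ω) g
    ≡⟨ ∑-map _ (linExts P) g ⟩
  ∑ (linExts P) (λ π → g (toList (Vec.map ω π)))
    ≡⟨ ∑-filter (isLinExt? P) (allWords p p) _ ⟩
  ∑ (allWords p p) (λ π → ind (does (isLinExt? P π)) * g (toList (Vec.map ω π)))
    ≡⟨ ∑-cong (allWords p p) (λ π → cong₂ (λ b w → ind b * g w)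
         (does-⇔ (mk⇔ (IsLinExt⇒LinExt P π) (LinExt⇒IsLinExt P π)) (isLinExt? P π) (linExt? P (toList π)))
         (Vec.toList-map ω π)) ⟩
  ∑ (allWords p p) (λ π → χ P (toList π) * g (map ω (toList π)))
    ≡⟨ ∑-allWords p p _ ⟩
  Words.∑W (allFin p) p (λ w → χ P w * g (map ω w)) ∎

-- From descents to peaks in one poset

[ab]^n : ∀ a b n → (a * b) ^ n ≡ a ^ n * b ^ n
[ab]^n a b zero    = refl
[ab]^n a b (suc n) = trans (cong (a * b *_) ([ab]^n a b n)) (interchange a b (a ^ n) (b ^ n))
  where
  interchange : ∀ a b c d → a * b * (c * d) ≡ a * c * (b * d)
  interchange = solve-∀

module _ {q : ℕ} (P : FinPoset (suc q)) (ω : Fin (suc q) → ℤ) (inj : Injective _≡_ _≡_ ω) where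
  open Words (allFin (suc q))
  private
    sgn = negative P ω

  -- Descents are taken for ω and peak weights for a second labelling ω′ of the same signs: ω itself
  -- in rank 0, the restriction of `ω̂` in rank 1.
  descent-peak : Alternating P sgn → (ω′ : Fin (suc q) → ℤ) (inj′ : Injective _≡_ _≡_ ω′) →
    (∀ x → negative P ω′ x ≡ sgn x) → ∀ t →
    + 2 * t * ((+ 2) ^ q * W P ω t) ≡ ∑W (suc q) (λ w → χ P w * weight (κ-peak t) (below ω′ inj′) sgn true w)
  descent-peak alt ω′ inj′ same t = begin
    + 2 * t * ((+ 2) ^ q * W P ω t)
      ≡⟨ cong (λ z → + 2 * t * ((+ 2) ^ q * z)) (trans (sym (∑-def (JH P ω) _)) (∑-JH P ω (λ w → t ^ des w))) ⟩
    + 2 * t * ((+ 2) ^ q * ∑W (suc q) (λ w → χ P w * t ^ des (map ω w)))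
      ≡⟨ trans (cong (+ 2 * t *_) (∑-*ˡ (words (suc q)) ((+ 2) ^ q) _)) (∑-*ˡ (words (suc q)) (+ 2 * t) _) ⟩
    ∑W (suc q) (λ w → + 2 * t * ((+ 2) ^ q * (χ P w * t ^ des (map ω w))))
      ≡⟨ ∑W-cong (allFin (suc q)) (suc q) (λ w len → by-descents w len (χ-cases P w)) ⟩
    ∑W (suc q) (λ w → χ P w * weight (κ-des t) (below ω inj) sgn true w)
      ≡⟨ ∑-cong (words (suc q)) (λ w → cong (_* weight (κ-des t) (below ω inj) sgn true w) (first-negative P alt w)) ⟨
    ∑W (suc q) (λ w → ind (startsWith sgn true w) * χ P w * weight (κ-des t) (below ω inj) sgn true w)
      ≡⟨ weight-transfer sgn (allFin (suc q)) (below-total ω inj) (below-total ω′ inj′) (cross-below P ω) cross′ (κ-sym t)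
           (suc q) (suc q) ℕ.≤-refl true (χ-symmetric P alt) ⟩
    ∑W (suc q) (λ w → ind (startsWith sgn true w) * χ P w * weight (κ-peak t) (below ω′ inj′) sgn true w)
      ≡⟨ ∑-cong (words (suc q)) (λ w → cong (_* weight (κ-peak t) (below ω′ inj′) sgn true w) (first-negative P alt w)) ⟩
    ∑W (suc q) (λ w → χ P w * weight (κ-peak t) (below ω′ inj′) sgn true w) ∎
    where
    cross′ : ∀ a b → sgn b ≡ not (sgn a) → below ω′ inj′ a b ≡ sgn a
    cross′ a b e = trans (cross-below P ω′ a b (trans (same b) (trans e (cong not (sym (same a)))))) (same a)

    by-descents : ∀ w → length w ≡ suc q → χ P w ≡ + 0 ⊎ LinExt P w →
      + 2 * t * ((+ 2) ^ q * (χ P w * t ^ des (map ω w))) ≡ χ P w * weight (κ-des t) (below ω inj) sgn true w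
    by-descents w       _    (inj₁ z) rewrite z = zeros t ((+ 2) ^ q) (t ^ des (map ω w)) (weight (κ-des t) (below ω inj) sgn true w)
      where
      zeros : ∀ t p d e → + 2 * t * (p * (+ 0 * d)) ≡ + 0 * e
      zeros = solve-∀
    by-descents (a ∷ w) ℓ (inj₂ (d , _)) = trans
      (pull t ((+ 2) ^ q) (χ P (a ∷ w)) (t ^ des (map ω (a ∷ w))))
      (cong (χ P (a ∷ w) *_) (sym (trans (weight-des ω inj t sgn true a w (AllPairs.map proj₁ d))
        (cong (λ n → + 2 * t * ((+ 2) ^ n * t ^ des (map ω (a ∷ w)))) (ℕ.suc-injective ℓ)))))
      where
      pull : ∀ t p c d → + 2 * t * (p * (c * d)) ≡ c * (+ 2 * t * (p * d))
      pull = solve-∀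

  peak-term : ℤ → ℕ → ℤ
  peak-term t i = (+ 4) ^ i * t ^ i * (+ 1 + t) ^ (q ∸ 2 ℕ.* i)

  peakCount-∑ : ∀ i → + peakCount P ω i ≡ ∑W (suc q) (λ w → χ P w * ind (does (peak (map ω w) ℕ.≟ i)))
  peakCount-∑ i = begin
    + peakCount P ω i
      ≡⟨ length-∑ (filter (λ w → peak w ℕ.≟ i) (JH P ω)) ⟩
    ∑ (filter (λ w → peak w ℕ.≟ i) (JH P ω)) (λ _ → + 1)
      ≡⟨ ∑-filter (λ w → peak w ℕ.≟ i) (JH P ω) _ ⟩
    ∑ (JH P ω) (λ w → ind (does (peak w ℕ.≟ i)) * + 1)
      ≡⟨ ∑-JH P ω _ ⟩
    ∑W (suc q) (λ w → χ P w * (ind (does (peak (map ω w) ℕ.≟ i)) * + 1))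
      ≡⟨ ∑-cong (words (suc q)) (λ w → cong (χ P w *_) (ℤ.*-identityʳ (ind (does (peak (map ω w) ℕ.≟ i))))) ⟩
    ∑W (suc q) (λ w → χ P w * ind (does (peak (map ω w) ℕ.≟ i))) ∎

  -- The last letter of a linear extension is maximal, hence negative, as `weight-valley` requires.
  -- Each extension then yields one term, which the indicator of its number of peaks selects from
  -- the sum over all i.
  peak-expansion : (∀ x → Maximal P x → sgn x ≡ true) → ∀ t →
    ∑W (suc q) (λ w → χ P w * weight (κ-peak t) (below ω inj) sgn true w) ≡
    + 2 * t * gammaExpansion q (λ i → (+ 4) ^ i * + peakCount P ω i) t
  peak-expansion maxneg t = begin
    ∑W (suc q) (λ w → χ P w * weight (κ-peak t) (below ω inj) sgn true w)
      ≡⟨ ∑W-cong (allFin (suc q)) (suc q) (λ w len → by-peaks w len (χ-cases P w)) ⟩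
    ∑W (suc q) (λ w → + 2 * t * ∑ I (λ i → χ P w * ind (does (peak (map ω w) ℕ.≟ i)) * peak-term t i))
      ≡⟨ ∑-*ˡ (words (suc q)) (+ 2 * t) _ ⟨
    + 2 * t * ∑W (suc q) (λ w → ∑ I (λ i → χ P w * ind (does (peak (map ω w) ℕ.≟ i)) * peak-term t i))
      ≡⟨ cong (+ 2 * t *_) (∑-swap (words (suc q)) I _) ⟩
    + 2 * t * ∑ I (λ i → ∑W (suc q) (λ w → χ P w * ind (does (peak (map ω w) ℕ.≟ i)) * peak-term t i))
      ≡⟨ cong (+ 2 * t *_) (∑-cong I λ i → trans (sym (∑-*ʳ (words (suc q)) (peak-term t i) _))
           (trans (cong (_* peak-term t i) (sym (peakCount-∑ i)))
             (rearrange (+ peakCount P ω i) ((+ 4) ^ i) (t ^ i) ((+ 1 + t) ^ (q ∸ 2 ℕ.* i))))) ⟩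
    + 2 * t * ∑ I (λ i → (+ 4) ^ i * + peakCount P ω i * t ^ i * (+ 1 + t) ^ (q ∸ 2 ℕ.* i))
      ≡⟨ cong (+ 2 * t *_) (∑-def I _) ⟩
    + 2 * t * gammaExpansion q (λ i → (+ 4) ^ i * + peakCount P ω i) t ∎
    where
    I = upTo (suc ⌊ q /2⌋)
    rearrange : ∀ n a b c → n * (a * b * c) ≡ a * n * b * c
    rearrange = solve-∀

    by-peaks : ∀ w → length w ≡ suc q → χ P w ≡ + 0 ⊎ LinExt P w →
      χ P w * weight (κ-peak t) (below ω inj) sgn true w ≡
      + 2 * t * ∑ I (λ i → χ P w * ind (does (peak (map ω w) ℕ.≟ i)) * peak-term t i)
    by-peaks w _ (inj₁ z) rewrite z = trans (ℤ.*-zeroˡ (weight (κ-peak t) (below ω inj) sgn true w))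
      (sym (trans (cong (+ 2 * t *_) (trans (∑-cong I λ i → zeros (ind (does (peak (map ω w) ℕ.≟ i))) (peak-term t i)) (∑-0 I))) (ℤ.*-zeroʳ (+ 2 * t))))
      where
      zeros : ∀ a b → + 0 * a * b ≡ + 0
      zeros = solve-∀
    by-peaks (a ∷ w) ℓ (inj₂ lin@(d , _))
      with weight-valley ω inj t sgn a w (AllPairs.map proj₁ d) (λ v x e → maxneg x (last-maximal P v x (subst (LinExt P) e lin)))
    ... | e , eq , len′ = begin
      χ P (a ∷ w) * weight (κ-peak t) (below ω inj) sgn true (a ∷ w)
        ≡⟨ cong (χ P (a ∷ w) *_) eq ⟩
      χ P (a ∷ w) * (+ 2 * t * ((+ 4 * t) ^ k * (+ 1 + t) ^ e))
        ≡⟨ cong₂ (λ y z → χ P (a ∷ w) * (+ 2 * t * (y * (+ 1 + t) ^ z))) ([ab]^n (+ 4) t k) e≡ ⟩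
      χ P (a ∷ w) * (+ 2 * t * peak-term t k)
        ≡⟨ pull (χ P (a ∷ w)) t (peak-term t k) ⟩
      + 2 * t * (χ P (a ∷ w) * peak-term t k)
        ≡⟨ cong (λ z → + 2 * t * (χ P (a ∷ w) * z)) (∑-upTo-select (suc ⌊ q /2⌋) k (peak-term t) (s≤s k≤)) ⟨
      + 2 * t * (χ P (a ∷ w) * ∑ I (λ i → ind (does (k ℕ.≟ i)) * peak-term t i))
        ≡⟨ cong (+ 2 * t *_) (trans (∑-*ˡ I (χ P (a ∷ w)) _) (∑-cong I λ i → sym (ℤ.*-assoc (χ P (a ∷ w)) (ind (does (k ℕ.≟ i))) (peak-term t i)))) ⟩
      + 2 * t * ∑ I (λ i → χ P (a ∷ w) * ind (does (k ℕ.≟ i)) * peak-term t i) ∎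
      where
      k = peak (map ω (a ∷ w))
      len : k ℕ.+ k ℕ.+ e ≡ q
      len = trans len′ (ℕ.suc-injective ℓ)
      pull : ∀ c t p → c * (+ 2 * t * p) ≡ + 2 * t * (c * p)
      pull = solve-∀
      e≡ : e ≡ q ∸ 2 ℕ.* k
      e≡ = trans (sym (ℕ.m+n∸m≡n (k ℕ.+ k) e)) (cong₂ _∸_ len (cong (k ℕ.+_) (sym (ℕ.+-identityʳ k))))
      k≤ : k ≤ ⌊ q /2⌋
      k≤ = subst (_≤ ⌊ q /2⌋) (sym (ℕ.n≡⌊n+n/2⌋ k)) (ℕ.⌊n/2⌋-mono (subst (k ℕ.+ k ≤_) len (ℕ.m≤m+n (k ℕ.+ k) e)))

∑-allFin-top : ∀ n (g : Fin (suc n) → ℤ) → ∑ (allFin (suc n)) g ≡ ∑ (allFin n) (g ∘ inject₁) + g (fromℕ n)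
∑-allFin-top n g = trans (go n (λ i → i)) (cong (_+ g (fromℕ n))
  (trans (cong (λ l → ∑ l g) (sym (map-tabulate (λ i → i) inject₁))) (∑-map inject₁ (allFin n) g)))
  where
  go : ∀ n {m} {h : Fin m → ℤ} (f : Fin (suc n) → Fin m) → ∑ (tabulate f) h ≡ ∑ (tabulate (f ∘ inject₁)) h + h (f (fromℕ n))
  go zero    {h = h} f = trans (∑-[x] _ h) (sym (trans (cong (_+ h (f zero)) (∑-[] h)) (ℤ.+-identityˡ _)))
  go (suc n) {h = h} f = begin
    ∑ (tabulate f) h                                                                   ≡⟨ ∑-∷ (f zero) _ h ⟩
    h (f zero) + ∑ (tabulate (f ∘ suc)) h                                              ≡⟨ cong (_+_ (h (f zero))) (go n (f ∘ suc)) ⟩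
    h (f zero) + (∑ (tabulate (f ∘ suc ∘ inject₁)) h + h (f (suc (fromℕ n))))          ≡⟨ ℤ.+-assoc (h (f zero)) _ _ ⟨
    h (f zero) + ∑ (tabulate (f ∘ suc ∘ inject₁)) h + h (f (suc (fromℕ n)))            ≡⟨ cong (_+ h (f (suc (fromℕ n)))) (∑-∷ (f zero) _ h) ⟨
    ∑ (tabulate (f ∘ inject₁)) h + h (f (fromℕ (suc n)))                               ∎

∑W-inject : ∀ n k (h : List (Fin (suc n)) → ℤ) → (∀ w → fromℕ n ∈ w → h w ≡ + 0) →
            Words.∑W (allFin (suc n)) k h ≡ Words.∑W (allFin n) k (h ∘ map inject₁)
∑W-inject n zero    h _   = trans (Words.∑W-zero (allFin (suc n)) h) (sym (Words.∑W-zero (allFin n) _))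
∑W-inject n (suc k) h off = begin
  Words.∑W (allFin (suc n)) (suc k) h
    ≡⟨ Words.∑W-suc (allFin (suc n)) k h ⟩
  ∑ (allFin (suc n)) (λ x → Words.∑W (allFin (suc n)) k (h ∘ (x ∷_)))
    ≡⟨ ∑-allFin-top n _ ⟩
  ∑ (allFin n) (λ x → Words.∑W (allFin (suc n)) k (h ∘ (inject₁ x ∷_))) + Words.∑W (allFin (suc n)) k (h ∘ (fromℕ n ∷_))
    ≡⟨ cong₂ _+_ (∑-cong (allFin n) λ x → ∑W-inject n k _ (λ w i → off (inject₁ x ∷ w) (there i)))
         (trans (∑-cong (Words.words (allFin (suc n)) k) (λ w → off (fromℕ n ∷ w) (here refl))) (∑-0 (Words.words (allFin (suc n)) k))) ⟩
  ∑ (allFin n) (λ x → Words.∑W (allFin n) k (h ∘ map inject₁ ∘ (x ∷_))) + + 0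
    ≡⟨ ℤ.+-identityʳ _ ⟩
  ∑ (allFin n) (λ x → Words.∑W (allFin n) k (h ∘ map inject₁ ∘ (x ∷_)))
    ≡⟨ Words.∑W-suc (allFin n) k _ ⟨
  Words.∑W (allFin n) (suc k) (h ∘ map inject₁) ∎

-- Adjoining a greatest element

module _ {p : ℕ} (P : FinPoset p) (P̂ : FinPoset (suc p)) (hat : IsHat P P̂) where
  private
    module P = FinPoset P
    module P̂ = FinPoset P̂
    module ≤P̂ = IsPartialOrder P̂.isPartialOrder
    ⊤̂ = fromℕ p

  <P⇒<P̂ : ∀ {x y} → x P.<P y → inject₁ x P̂.<P inject₁ y
  <P⇒<P̂ {x} {y} (x≤y , x≢y) = proj₂ (proj₁ hat x y) x≤y , λ e → x≢y (Fin.inject₁-injective e)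

  <P̂⇒<P : ∀ {x y} → inject₁ x P̂.<P inject₁ y → x P.<P y
  <P̂⇒<P {x} {y} (x≤y , x≢y) = proj₁ (proj₁ hat x y) x≤y , λ e → x≢y (cong inject₁ e)

  inject<⊤̂ : ∀ x → inject₁ x P̂.<P ⊤̂
  inject<⊤̂ x = proj₂ hat (inject₁ x) , λ e → Fin.fromℕ≢inject₁ (sym e)

  ⊤̂≮ : ∀ y → ¬ (⊤̂ P̂.<P y)
  ⊤̂≮ y (⊤≤y , ⊤≢y) = ⊤≢y (≤P̂.antisym ⊤≤y (proj₂ hat y))

  maximal-P̂ : ∀ y → P̂.Maximal y → y ≡ ⊤̂
  maximal-P̂ y max with view y
  ... | ‵fromℕ     = refl
  ... | ‵inject₁ x = contradiction (inject<⊤̂ x) (max ⊤̂)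

  minimal-inject : ∀ x → P.Minimal x → P̂.Minimal (inject₁ x)
  minimal-inject x min y y<x with view y
  ... | ‵fromℕ     = ⊤̂≮ (inject₁ x) y<x
  ... | ‵inject₁ z = min z (<P̂⇒<P y<x)

  cover-inject : ∀ x y → x P.⋖ y → inject₁ x P̂.⋖ inject₁ y
  cover-inject x y (x<y , none) = <P⇒<P̂ x<y , none′
    where
    none′ : ∀ z → ¬ ((inject₁ x P̂.<P z) × (z P̂.<P inject₁ y))
    none′ z (x<z , z<y) with view z
    ... | ‵fromℕ     = ⊤̂≮ (inject₁ y) z<y
    ... | ‵inject₁ w = none w (<P̂⇒<P x<z , <P̂⇒<P z<y)

  -- Minimal elements and covers of `P` remain such in `P̂`, so both patterns obey the same
  -- recursion.
  sign-inject : ∀ {sgn sgn̂} → Alternating P sgn → Alternating P̂ sgn̂ → ∀ x → sgn̂ (inject₁ x) ≡ sgn x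
  sign-inject alt alt̂ = cover-induction P _
    (λ x min → trans (Alternating.minimal alt̂ (inject₁ x) (minimal-inject x min)) (sym (Alternating.minimal alt x min)))
    (λ x y x⋖y ih → trans (Alternating.cover alt̂ _ _ (cover-inject x y x⋖y)) (trans (cong not ih) (sym (Alternating.cover alt x y x⋖y))))

  -- A lower cover of `⊤̂` is a maximal element of `P`, as anything above it would lie strictly
  -- between, and so it is positive. The element of `Fin p` provides such a cover.
  sign-⊤̂ : ∀ {sgn sgn̂} → Alternating P sgn → Alternating P̂ sgn̂ → (∀ x → P.Maximal x → sgn x ≡ false) → Fin p → sgn̂ ⊤̂ ≡ true
  sign-⊤̂ alt alt̂ max x with cover-below P̂ (inject<⊤̂ x)
  ... | z , z⋖⊤ , _ with view z
  ... | ‵fromℕ     = contradiction refl (proj₂ (proj₁ z⋖⊤))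
  ... | ‵inject₁ y = trans (Alternating.cover alt̂ _ _ z⋖⊤) (cong not (trans (sign-inject alt alt̂ y)
        (max y (λ u y<u → proj₂ z⋖⊤ (inject₁ u) (<P⇒<P̂ y<u , inject<⊤̂ u)))))

  LinExt-∷ʳ⊤̂ : ∀ w → LinExt P w → LinExt P̂ (map inject₁ w ∷ʳ ⊤̂)
  LinExt-∷ʳ⊤̂ w (pairs , complete) =
    AllPairs.++⁺ (AllPairs.map⁺ (AllPairs.map (λ (n , m) → (λ e → n (Fin.inject₁-injective e)) , λ q → m (<P̂⇒<P q)) pairs))
                 ([] ∷ [])
                 (All.map⁺ (All.universal (λ x → (((λ e → Fin.fromℕ≢inject₁ (sym e)) , ⊤̂≮ (inject₁ x)) ∷ [])) w))
    , complete′
    where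
    complete′ : ∀ z → z ∈ map inject₁ w ∷ʳ ⊤̂
    complete′ z with view z
    ... | ‵fromℕ     = ∈-++⁺ʳ (map inject₁ w) (here refl)
    ... | ‵inject₁ x = ∈-++⁺ˡ (∈-map⁺ inject₁ (complete x))

  LinExt-∷ʳ⊤̂⁻ : ∀ w → LinExt P̂ (map inject₁ w ∷ʳ ⊤̂) → LinExt P w
  LinExt-∷ʳ⊤̂⁻ w (pairs , complete) =
    AllPairs.map (λ (n , m) → (λ e → n (cong inject₁ e)) , λ q → m (<P⇒<P̂ q)) (AllPairs.map⁻ (AllPairs-++ˡ (map inject₁ w) pairs))
    , complete′
    where
    complete′ : ∀ z → z ∈ w
    complete′ z with ∈-++⁻ (map inject₁ w) (complete (inject₁ z))
    ... | inj₂ (here e) = contradiction (sym e) Fin.fromℕ≢inject₁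
    ... | inj₁ i with ∈-map⁻ inject₁ i
    ...   | y , y∈w , e = subst (_∈ w) (sym (Fin.inject₁-injective e)) y∈w

  -- Linear extensions of `P̂` are those of `P` followed by `⊤̂`: another last letter would not be
  -- maximal, and an earlier `⊤̂` would be repeated.
  ∑-hat : ∀ (h : List (Fin (suc p)) → ℤ) →
    Words.∑W (allFin (suc p)) (suc p) (λ w → χ P̂ w * h w) ≡
    Words.∑W (allFin p) p (λ w → χ P w * h (map inject₁ w ∷ʳ ⊤̂))
  ∑-hat h = begin
    ∑̂ (suc p) (λ w → χ P̂ w * h w)
      ≡⟨ Words.∑W-∷ʳ (allFin (suc p)) p _ ⟩
    ∑ (allFin (suc p)) (λ x → ∑̂ p (λ u → χ P̂ (u ∷ʳ x) * h (u ∷ʳ x)))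
      ≡⟨ ∑-allFin-top p _ ⟩
    ∑ (allFin p) (λ x → ∑̂ p (λ u → χ P̂ (u ∷ʳ inject₁ x) * h (u ∷ʳ inject₁ x))) + ∑̂ p (λ u → χ P̂ (u ∷ʳ ⊤̂) * h (u ∷ʳ ⊤̂))
      ≡⟨ cong₂ _+_ (trans (∑-cong (allFin p) λ x → trans (∑-cong (Words.words (allFin (suc p)) p) λ u → vanish u x (χ-cases P̂ (u ∷ʳ inject₁ x)))
           (∑-0 (Words.words (allFin (suc p)) p))) (∑-0 (allFin p)))
           (∑W-inject p p _ (λ u i → repeated u i (χ-cases P̂ (u ∷ʳ ⊤̂)))) ⟩
    + 0 + Words.∑W (allFin p) p (λ w → χ P̂ (map inject₁ w ∷ʳ ⊤̂) * h (map inject₁ w ∷ʳ ⊤̂))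
      ≡⟨ ℤ.+-identityˡ _ ⟩
    Words.∑W (allFin p) p (λ w → χ P̂ (map inject₁ w ∷ʳ ⊤̂) * h (map inject₁ w ∷ʳ ⊤̂))
      ≡⟨ ∑-cong (Words.words (allFin p) p) (λ w → cong (λ b → ind b * h (map inject₁ w ∷ʳ ⊤̂))
           (does-⇔ (mk⇔ (LinExt-∷ʳ⊤̂⁻ w) (LinExt-∷ʳ⊤̂ w)) (linExt? P̂ _) (linExt? P w))) ⟩
    Words.∑W (allFin p) p (λ w → χ P w * h (map inject₁ w ∷ʳ ⊤̂)) ∎
    where
    ∑̂ = Words.∑W (allFin (suc p))
    vanish : ∀ u x → χ P̂ (u ∷ʳ inject₁ x) ≡ + 0 ⊎ LinExt P̂ (u ∷ʳ inject₁ x) → χ P̂ (u ∷ʳ inject₁ x) * h (u ∷ʳ inject₁ x) ≡ + 0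
    vanish u x (inj₁ z) = trans (cong (_* h (u ∷ʳ inject₁ x)) z) (ℤ.*-zeroˡ (h (u ∷ʳ inject₁ x)))
    vanish u x (inj₂ l) = contradiction (inject<⊤̂ x) (last-maximal P̂ u (inject₁ x) l ⊤̂)
    repeated : ∀ u → ⊤̂ ∈ u → χ P̂ (u ∷ʳ ⊤̂) ≡ + 0 ⊎ LinExt P̂ (u ∷ʳ ⊤̂) → χ P̂ (u ∷ʳ ⊤̂) * h (u ∷ʳ ⊤̂) ≡ + 0
    repeated u i (inj₁ z)           = trans (cong (_* h (u ∷ʳ ⊤̂)) z) (ℤ.*-zeroˡ (h (u ∷ʳ ⊤̂)))
    repeated u i (inj₂ (pairs , _)) = contradiction refl (proj₁ (AllPairs-cross u pairs i (here refl)))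

  -- The last letter of the old word is positive, so its end flag says that a smaller letter
  -- follows, and the negative `⊤̂` is one. Nothing before `⊤̂` changes, and `⊤̂` itself is a
  -- valley.
  weight-∷ʳ⊤̂ : ∀ κ (ω̂ : Fin (suc p) → ℤ) (inĵ : Injective _≡_ _≡_ ω̂) (inj′ : Injective _≡_ _≡_ (ω̂ ∘ inject₁)) →
    ∀ sgn → (∀ x → negative P̂ ω̂ (inject₁ x) ≡ sgn x) → negative P̂ ω̂ ⊤̂ ≡ true →
    ∀ l a w → (∀ v x → a ∷ w ≡ v ∷ʳ x → sgn x ≡ false) →
    weight κ (below ω̂ inĵ) (negative P̂ ω̂) l (map inject₁ (a ∷ w) ∷ʳ ⊤̂) ≡ weight κ (below (ω̂ ∘ inject₁) inj′) sgn l (a ∷ w) * κ true true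
  weight-∷ʳ⊤̂ κ ω̂ inĵ inj′ sgn same ⊤-neg l a [] last
    rewrite ⊤-neg | trans (cross-below P̂ ω̂ (inject₁ a) ⊤̂ (trans ⊤-neg (cong not (sym (trans (same a) (last [] a refl)))))) (same a)
          | last [] a refl = refl
  weight-∷ʳ⊤̂ κ ω̂ inĵ inj′ sgn same ⊤-neg l a (b ∷ w) last = trans
    (cong (κ l (below ω̂ inĵ (inject₁ a) (inject₁ b)) *_)
      (weight-∷ʳ⊤̂ κ ω̂ inĵ inj′ sgn same ⊤-neg (not (below ω̂ inĵ (inject₁ a) (inject₁ b))) b w (λ v x e → last (a ∷ v) x (cong (a ∷_) e))))
    (sym (ℤ.*-assoc (κ l (below ω̂ inĵ (inject₁ a) (inject₁ b))) _ (κ true true)))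

-- Comparison of coefficients in ranks 0 and 1

gammaExpansion-∑ : ∀ d a t → gammaExpansion d a t ≡ ∑ (upTo (suc ⌊ d /2⌋)) (λ i → a i * t ^ i * (+ 1 + t) ^ (d ∸ 2 ℕ.* i))
gammaExpansion-∑ d a t = sym (∑-def (upTo (suc ⌊ d /2⌋)) _)

gammaExpansion-unique : ∀ d a b → (∀ k → gammaExpansion d a (+ suc k) ≡ gammaExpansion d b (+ suc k)) →
                        ∀ i → i ≤ ⌊ d /2⌋ → a i ≡ b i
gammaExpansion-unique d a b H i i≤ = expansion-unique (suc ⌊ d /2⌋) (λ i → d ∸ 2 ℕ.* i) a b
  (λ k → trans (sym (gammaExpansion-∑ d a (+ suc k))) (trans (H k) (gammaExpansion-∑ d b (+ suc k)))) i (s≤s i≤)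

gammaExpansion-*ˡ : ∀ d c a t → c * gammaExpansion d a t ≡ gammaExpansion d (λ i → c * a i) t
gammaExpansion-*ˡ d c a t = begin
  c * gammaExpansion d a t                                                   ≡⟨ cong (c *_) (gammaExpansion-∑ d a t) ⟩
  c * ∑ I (λ i → a i * t ^ i * (+ 1 + t) ^ (d ∸ 2 ℕ.* i))                    ≡⟨ ∑-*ˡ I c _ ⟩
  ∑ I (λ i → c * (a i * t ^ i * (+ 1 + t) ^ (d ∸ 2 ℕ.* i)))                  ≡⟨ ∑-cong I (λ i → assoc c (a i) (t ^ i) ((+ 1 + t) ^ (d ∸ 2 ℕ.* i))) ⟩
  ∑ I (λ i → c * a i * t ^ i * (+ 1 + t) ^ (d ∸ 2 ℕ.* i))                    ≡⟨ gammaExpansion-∑ d (λ i → c * a i) t ⟨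
  gammaExpansion d (λ i → c * a i) t                                         ∎
  where
  I = upTo (suc ⌊ d /2⌋)
  assoc : ∀ c a x y → c * (a * x * y) ≡ c * a * x * y
  assoc = solve-∀

shift : (ℕ → ℤ) → ℕ → ℤ
shift a zero    = + 0
shift a (suc i) = a i

-- The powers of 1 + t stay, because d - 2i = (d + 2) - 2(i + 1).
gammaExpansion-shift : ∀ d a t → t * gammaExpansion d a t ≡ gammaExpansion (suc (suc d)) (shift a) t
gammaExpansion-shift d a t = begin
  t * gammaExpansion d a t
    ≡⟨ cong (t *_) (gammaExpansion-∑ d a t) ⟩
  t * ∑ I (λ i → a i * t ^ i * (+ 1 + t) ^ (d ∸ 2 ℕ.* i))
    ≡⟨ ∑-*ˡ I t _ ⟩
  ∑ I (λ i → t * (a i * t ^ i * (+ 1 + t) ^ (d ∸ 2 ℕ.* i)))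
    ≡⟨ ∑-cong I (λ i → trans (push t (a i) (t ^ i) _) (cong (λ n → a i * (t * t ^ i) * (+ 1 + t) ^ (suc d ∸ n)) (sym (ℕ.+-suc i (i ℕ.+ 0))))) ⟩
  ∑ I (λ i → a i * t ^ suc i * (+ 1 + t) ^ (suc (suc d) ∸ 2 ℕ.* suc i))
    ≡⟨ ℤ.+-identityˡ _ ⟨
  + 0 + ∑ I (λ i → a i * t ^ suc i * (+ 1 + t) ^ (suc (suc d) ∸ 2 ℕ.* suc i))
    ≡⟨ cong (_+ ∑ I (λ i → a i * t ^ suc i * (+ 1 + t) ^ (suc (suc d) ∸ 2 ℕ.* suc i))) (zeros ((+ 1 + t) ^ suc (suc d))) ⟨
  + 0 * + 1 * (+ 1 + t) ^ suc (suc d) + ∑ I (λ i → a i * t ^ suc i * (+ 1 + t) ^ (suc (suc d) ∸ 2 ℕ.* suc i))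
    ≡⟨ ∑-upTo-suc (suc ⌊ d /2⌋) (λ i → shift a i * t ^ i * (+ 1 + t) ^ (suc (suc d) ∸ 2 ℕ.* i)) ⟨
  ∑ (upTo (suc (suc ⌊ d /2⌋))) (λ i → shift a i * t ^ i * (+ 1 + t) ^ (suc (suc d) ∸ 2 ℕ.* i))
    ≡⟨ gammaExpansion-∑ (suc (suc d)) (shift a) t ⟨
  gammaExpansion (suc (suc d)) (shift a) t ∎
  where
  I = upTo (suc ⌊ d /2⌋)
  push : ∀ t a x y → t * (a * x * y) ≡ a * (t * x) * y
  push = solve-∀
  zeros : ∀ x → + 0 * + 1 * x ≡ + 0
  zeros = solve-∀

rank0 : ∀ q (P : FinPoset (suc q)) (ω : Labeling (suc q)) a → Canonical P (proj₁ ω) → SignGraded P (proj₁ ω) (+ 0) →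
  (∀ t → W P (proj₁ ω) t ≡ gammaExpansion q a t) →
  ∀ i → i ≤ ⌊ q /2⌋ → (+ 2) ^ q * a i ≡ (+ 4) ^ i * + peakCount P (proj₁ ω) i
rank0 q P (ω , inj) a can graded expand = gammaExpansion-unique q (λ i → (+ 2) ^ q * a i) (λ i → (+ 4) ^ i * + peakCount P ω i) λ k →
  -- Positive values of t suffice to determine the coefficients, and they allow cancelling 2t.
  ℤ.*-cancelˡ-≡ (+ 2 * + suc k) _ _ (begin
    + 2 * + suc k * gammaExpansion q (λ i → (+ 2) ^ q * a i) (+ suc k)
      ≡⟨ cong (+ 2 * + suc k *_) (gammaExpansion-*ˡ q ((+ 2) ^ q) a (+ suc k)) ⟨
    + 2 * + suc k * ((+ 2) ^ q * gammaExpansion q a (+ suc k))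
      ≡⟨ cong (λ z → + 2 * + suc k * ((+ 2) ^ q * z)) (expand (+ suc k)) ⟨
    + 2 * + suc k * ((+ 2) ^ q * W P ω (+ suc k))
      ≡⟨ descent-peak P ω inj (canonical⇒alternating P ω can) ω inj (λ _ → refl) (+ suc k) ⟩
    _
      ≡⟨ peak-expansion P ω inj (maximal-rank0 P ω can graded) (+ suc k) ⟩
    + 2 * + suc k * gammaExpansion q (λ i → (+ 4) ^ i * + peakCount P ω i) (+ suc k) ∎)

-- The expansion for `P̂` has degree p = d + 2, just that of t times the expansion of `W`. Comparing
-- coefficients at i + 1 leaves 2^(d+2) against 4^(i+1), from which a 4 cancels.
rank1 : ∀ d (P : FinPoset (suc (suc d))) (ω : Labeling (suc (suc d))) a → Canonical P (proj₁ ω) → SignGraded P (proj₁ ω) (+ 1) →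
  (∀ t → W P (proj₁ ω) t ≡ gammaExpansion d a t) →
  ∀ (P̂ : FinPoset (suc (suc (suc d)))) (ω̂ : Labeling (suc (suc (suc d)))) → IsHat P P̂ → Canonical P̂ (proj₁ ω̂) →
  ∀ i → i ≤ ⌊ d /2⌋ → (+ 2) ^ d * a i ≡ (+ 4) ^ i * + peakCount P̂ (proj₁ ω̂) (suc i)
rank1 d P (ω , inj) a can graded expand P̂ (ω̂ , inĵ) hat can̂ i i≤ = ℤ.*-cancelˡ-≡ (+ 4) _ _ (begin
    + 4 * ((+ 2) ^ d * a i)                                  ≡⟨ fold ((+ 2) ^ d) (a i) ⟩
    (+ 2) ^ suc (suc d) * a i                                ≡⟨ coefficients (suc i) (s≤s i≤) ⟩
    (+ 4) ^ suc i * + peakCount P̂ ω̂ (suc i)                  ≡⟨ ℤ.*-assoc (+ 4) ((+ 4) ^ i) _ ⟩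
    + 4 * ((+ 4) ^ i * + peakCount P̂ ω̂ (suc i))              ∎)
  where
  p = suc (suc d)
  fold : ∀ x a → + 4 * (x * a) ≡ + 2 * (+ 2 * x) * a
  fold = solve-∀
  alt  = canonical⇒alternating P ω can
  alt̂  = canonical⇒alternating P̂ ω̂ can̂
  sgn  = negative P ω
  same = sign-inject P P̂ hat alt alt̂
  max  = maximal-rank1 P ω can graded
  top-neg = sign-⊤̂ P P̂ hat alt alt̂ max zero
  inj′ : Injective _≡_ _≡_ (ω̂ ∘ inject₁)
  inj′ e = Fin.inject₁-injective (inĵ e)

  append : ∀ t w → length w ≡ p → χ P w ≡ + 0 ⊎ LinExt P w →
    χ P w * weight (κ-peak t) (below ω̂ inĵ) (negative P̂ ω̂) true (map inject₁ w ∷ʳ fromℕ p) ≡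
    χ P w * weight (κ-peak t) (below (ω̂ ∘ inject₁) inj′) sgn true w * (+ 2 * t)
  append t w _ (inj₁ z) rewrite z = zeros
    (weight (κ-peak t) (below ω̂ inĵ) (negative P̂ ω̂) true (map inject₁ w ∷ʳ fromℕ p)) (weight (κ-peak t) (below (ω̂ ∘ inject₁) inj′) sgn true w) t
    where
    zeros : ∀ x y t → + 0 * x ≡ + 0 * y * (+ 2 * t)
    zeros = solve-∀
  append t (x ∷ w) _ (inj₂ lin) = trans
    (cong (χ P (x ∷ w) *_) (weight-∷ʳ⊤̂ P P̂ hat (κ-peak t) ω̂ inĵ inj′ sgn same top-neg true x w
      (λ v y e → max y (last-maximal P v y (subst (LinExt P) e lin)))))
    (sym (ℤ.*-assoc (χ P (x ∷ w)) (weight (κ-peak t) (below (ω̂ ∘ inject₁) inj′) sgn true (x ∷ w)) (+ 2 * t)))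

  -- The inner 2t comes with the descents of ω, the outer one is the valley at `⊤̂`.
  doubled : ∀ t → + 2 * t * (+ 2 * t * ((+ 2) ^ suc d * W P ω t)) ≡ + 2 * t * gammaExpansion p (λ i → (+ 4) ^ i * + peakCount P̂ ω̂ i) t
  doubled t = begin
    + 2 * t * (+ 2 * t * ((+ 2) ^ suc d * W P ω t))
      ≡⟨ cong (+ 2 * t *_) (descent-peak P ω inj alt (ω̂ ∘ inject₁) inj′ same t) ⟩
    + 2 * t * Words.∑W (allFin p) p (λ w → χ P w * weight (κ-peak t) (below (ω̂ ∘ inject₁) inj′) sgn true w)
      ≡⟨ ℤ.*-comm (+ 2 * t) _ ⟩
    Words.∑W (allFin p) p (λ w → χ P w * weight (κ-peak t) (below (ω̂ ∘ inject₁) inj′) sgn true w) * (+ 2 * t)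
      ≡⟨ ∑-*ʳ (Words.words (allFin p) p) (+ 2 * t) _ ⟩
    Words.∑W (allFin p) p (λ w → χ P w * weight (κ-peak t) (below (ω̂ ∘ inject₁) inj′) sgn true w * (+ 2 * t))
      ≡⟨ ∑W-cong (allFin p) p (λ w len → append t w len (χ-cases P w)) ⟨
    Words.∑W (allFin p) p (λ w → χ P w * weight (κ-peak t) (below ω̂ inĵ) (negative P̂ ω̂) true (map inject₁ w ∷ʳ fromℕ p))
      ≡⟨ ∑-hat P P̂ hat (weight (κ-peak t) (below ω̂ inĵ) (negative P̂ ω̂) true) ⟨
    Words.∑W (allFin (suc p)) (suc p) (λ w → χ P̂ w * weight (κ-peak t) (below ω̂ inĵ) (negative P̂ ω̂) true w)
      ≡⟨ peak-expansion P̂ ω̂ inĵ (λ y m → trans (cong (negative P̂ ω̂) (maximal-P̂ P P̂ hat y m)) top-neg) t ⟩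
    + 2 * t * gammaExpansion p (λ i → (+ 4) ^ i * + peakCount P̂ ω̂ i) t ∎

  coefficients : ∀ i → i ≤ ⌊ p /2⌋ → shift (λ i → (+ 2) ^ suc (suc d) * a i) i ≡ (+ 4) ^ i * + peakCount P̂ ω̂ i
  coefficients = gammaExpansion-unique p (shift (λ i → (+ 2) ^ suc (suc d) * a i)) (λ i → (+ 4) ^ i * + peakCount P̂ ω̂ i) λ k → let t = + suc k in begin
    gammaExpansion p (shift (λ i → (+ 2) ^ suc (suc d) * a i)) t
      ≡⟨ gammaExpansion-shift d (λ i → (+ 2) ^ suc (suc d) * a i) t ⟨
    t * gammaExpansion d (λ i → (+ 2) ^ suc (suc d) * a i) t
      ≡⟨ cong (t *_) (gammaExpansion-*ˡ d ((+ 2) ^ suc (suc d)) a t) ⟨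
    t * ((+ 2) ^ suc (suc d) * gammaExpansion d a t)
      ≡⟨ cong (λ z → t * ((+ 2) ^ suc (suc d) * z)) (expand t) ⟨
    t * ((+ 2) ^ suc (suc d) * W P ω t)
      ≡⟨ regroup t ((+ 2) ^ suc d) (W P ω t) ⟩
    + 2 * t * ((+ 2) ^ suc d * W P ω t)
      ≡⟨ ℤ.*-cancelˡ-≡ (+ 2 * t) _ _ (doubled t) ⟩
    gammaExpansion p (λ i → (+ 4) ^ i * + peakCount P̂ ω̂ i) t ∎
    where
    regroup : ∀ t x w → t * (+ 2 * x * w) ≡ + 2 * t * (x * w)
    regroup = solve-∀

theorem6p4 :
  ∀ (p : ℕ) (P : FinPoset p) (ω : Labeling p) (r : ℤ) (a : ℕ → ℤ) →
  1 ≤ p →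
  Canonical P (proj₁ ω) →
  SignGraded P (proj₁ ω) r →
  -- case r = 0, d = p - 1
  (r ≡ + 0 →
    (∀ t → W P (proj₁ ω) t ≡ gammaExpansion (p ∸ 1) a t) →
    ∀ i → i ≤ ⌊ p ∸ 1 /2⌋ →
      (+ 2) ^ (p ∸ 1) * a i ≡ (+ 4) ^ i * + peakCount P (proj₁ ω) i)
  ×
  -- case r = 1, d = p - 2
  (r ≡ + 1 →
    (∀ t → W P (proj₁ ω) t ≡ gammaExpansion (p ∸ 2) a t) →
    ∀ (P̂ : FinPoset (suc p)) (ω̂ : Labeling (suc p)) →
    IsHat P P̂ →
    Canonical P̂ (proj₁ ω̂) →
    ∀ i → i ≤ ⌊ p ∸ 2 /2⌋ →
      (+ 2) ^ (p ∸ 2) * a i ≡ (+ 4) ^ i * + peakCount P̂ (proj₁ ω̂) (suc i))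
theorem6p4 (suc zero) P ω r a _ can graded =
  (λ { refl → rank0 0 P ω a can graded }) ,
  -- A single point is a maximal chain with ε-sum 0, so its rank is not 1.
  (λ { refl _ _ _ _ _ _ _ → contradiction
         (graded zero zero [ zero ] (λ y q → proj₂ q (only y zero)) (λ y q → proj₂ q (only zero y))) λ () })
  where
  only : (x y : Fin 1) → x ≡ y
  only zero zero = refl
theorem6p4 (suc (suc d)) P ω r a _ can graded =
  (λ { refl → rank0 (suc d) P ω a can graded }) ,
  (λ { refl → rank1 d P ω a can graded })
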